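{- For any permutations $\sigma$ and $\pi$, $$\mu(\sigma,\pi)=(-1)^{|\pi|-|\sigma|}\,\mathrm{NE}(\sigma,\pi)+\sum_{\lambda\in[\sigma,\pi)}\mu(\sigma,\lambda)\,\mathrm{EZ}(\lambda,\pi),$$ where $\mu$ is the Möbius function of the permutation pattern poset $\mathcal{P}$.
   Context: A permutation of length $n\ge 1$ is written in one-line notation $\pi=\pi_1\cdots\pi_n$, and $|\pi|=n$. An occurrence of $\sigma$ in $\pi$ is a subsequence of $\pi$ (a choice of positions) whose letters are in the same relative order of size as the letters of $\sigma$. The poset $\mathcal{P}$ is the set of all permutations with $\sigma\le\pi$ iff there is an occurrence of $\sigma$ in $\pi$; $[\sigma,\pi)=\{\lambda\in\mathcal{P}: \sigma\le\lambda<\pi\}$. The Möbius function is given by $\mu(a,b)=0$ if $a\not\le b$, $\mu(a,a)=1$, and $\mu(a,b)=-\sum_{a\le z<b}\mu(a,z)$ for $a<b$. An adjacency in a permutation $\pi$ is a maximal sequence (of length $\ge 1$) of letters in consecutive positions that have consecutive values and are increasing or decreasing. The adjacencies partition the positions of $\pi$. The tail of an adjacency of length at least 2 is all but its first letter; an adjacency of length 1 has no tail. (E.g. $2314765$ has adjacencies $23,1,4,765$ and tails $3$ and $65$.) An embedding $\eta$ of $\sigma$ in $\pi$ is a sequence of length $|\pi|$ whose nonzero letters are the letters of an occurrence of $\sigma$ in $\pi$, in the same positions as in $\pi$, all other entries being $0$. An embedding $\eta$ is normal if $\eta_i\neq 0$ at every position $i$ of a letter belonging to the tail of an adjacency of $\pi$.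 $\mathrm{NE}(\sigma,\pi)$ is the number of normal embeddings of $\sigma$ in $\pi$. Two embeddings of $\sigma$ in $\pi$ are equivalent if they differ only within adjacencies of $\pi$, i.e. for every adjacency of $\pi$ they have the same number of nonzero entries among the positions of that adjacency. $\widehat{E}^{\sigma,\pi}$ is the set consisting of the rightmost embedding of each equivalence class, i.e. the one whose nonzero entries within each adjacency occupy the last positions of that adjacency. For $\eta\in\widehat{E}^{\sigma,\pi}$ let $Z(\eta)=\{i:\eta_i=0\}$. $\mathrm{EZ}^{\sigma,\pi}$ is the set of all nonempty subsets $S\subseteq\widehat{E}^{\sigma,\pi}$ with $\bigcap_{\eta\in S}Z(\eta)=\emptyset$, and $\mathrm{EZ}(\sigma,\pi):=\sum_{S\in\mathrm{EZ}^{\sigma,\pi}}(-1)^{|S|}$. -}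

module Defs where

open import Data.Bool.Base using (if_then_else_)
import Data.Bool.Properties as Bool
open import Data.Fin.Base as Fin using (Fin; toℕ; opposite)
open import Data.Fin.Properties as Fin using (all?; any?)
open import Data.Fin.Subset as Subset using (Subset; ⋂)
open import Data.Integer.Base using (ℤ; +_; _+_; -_; _^_; 0ℤ; 1ℤ; -1ℤ)
open import Data.List.Base
  using (List; []; _∷_; map; _++_; foldr; filter; length; allFin; upTo; concatMap; mapMaybe; cartesianProductWith)
open import Data.List.Membership.Propositional using (_∈_; find; lose)
open import Data.List.Membership.Propositional.Properties
  using (∈-cartesianProductWith⁺; ∈-allFin; ∈-filter⁺; ∈-filter⁻; ∈-concatMap⁺; ∈-map⁺; ∈-map⁻; ∈-upTo⁺)
import Data.List.Properties as List
open import Data.List.Relation.Binary.Disjoint.Propositional using (Disjoint)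
import Data.List.Relation.Unary.All as ListAll
import Data.List.Relation.Unary.All.Properties as ListAll
open import Data.List.Relation.Unary.AllPairs as ListPairs using ([]; _∷_)
import Data.List.Relation.Unary.AllPairs.Properties as ListPairs
import Data.List.Relation.Unary.Unique.Propositional as ListUnique
import Data.List.Relation.Unary.Unique.Propositional.Properties as ListUnique
import Data.List.Relation.Unary.Any as ListAny
import Data.List.Relation.Unary.Any.Properties as ListAny
open import Data.Maybe.Base using (Maybe; just; nothing)
open import Data.Maybe.Relation.Unary.Any as MaybeAny using (just)
open import Data.Nat.Base as ℕ using (ℕ; zero; suc; s≤s; z≤n)
import Data.Nat.Properties as ℕ
open import Data.Product.Base using (Σ; ∃; _×_; _,_; proj₁; proj₂)
import Data.Product.Properties as Product
open import Data.Sum.Base using (_⊎_)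
open import Data.Vec.Base as Vec using (Vec; []; _∷_; lookup; tabulate)
open import Data.Vec.Properties as Vec using (lookup∘tabulate; tabulate∘lookup; tabulate-cong)
open import Data.Vec.Membership.Propositional using () renaming (_∈_ to _∈ᵛ_)
import Data.Vec.Membership.DecPropositional as VecMembership
open import Data.Vec.Relation.Unary.AllPairs using (allPairs?)
open import Data.Vec.Relation.Unary.Unique.Propositional using (Unique)
open import Data.Vec.Relation.Unary.Unique.Setoid.Properties using (lookup-injective)
open import Function.Base using (id; _∘_)
open import Function.Bundles using (_⇔_; mk⇔; Equivalence)
open import Relation.Binary.Definitions using (DecidableEquality; Decidable; tri<; tri≈; tri>)
open import Relation.Binary.PropositionalEquality
  using (_≡_; _≢_; refl; sym; trans; cong; subst; subst₂; setoid)
open import Relation.Nullary.Decidable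
  using (Dec; yes; no; does; map′; recompute; ¬?; _×-dec_; _⊎-dec_; _→-dec_; dec-true; dec-false)
open import Relation.Nullary.Negation using (¬_; contradiction)
import Relation.Unary as Unary

private
  variable
    A B : Set
    k m n : ℕ

  _⇔-dec_ : Dec A → Dec B → Dec (A ⇔ B)
  a? ⇔-dec b? =
    map′ (λ (f , g) → mk⇔ f g) (λ e → Equivalence.to e , Equivalence.from e)
         ((a? →-dec b?) ×-dec (b? →-dec a?))

∑ : List A → (A → ℤ) → ℤ
∑ xs f = foldr _+_ 0ℤ (map f xs)

syntax ∑ xs (λ x → e) = ∑[ x ← xs ] e

vectors : List A → (k : ℕ) → List (Vec A k)
vectors xs zero    = [] ∷ []
vectors xs (suc k) = cartesianProductWith _∷_ xs (vectors xs k)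

-- When the list has no duplicates, these are its subsets, each listed once.
sublists : List A → List (List A)
sublists []       = [] ∷ []
sublists (x ∷ xs) = map (x ∷_) (sublists xs) ++ sublists xs

∈-vectors : {xs : List A} → (∀ x → x ∈ xs) → (v : Vec A k) → v ∈ vectors xs k
∈-vectors all []      = ListAny.here refl
∈-vectors all (x ∷ v) = ∈-cartesianProductWith⁺ _∷_ (all x) (∈-vectors all v)

anyVec? : {P : Vec (Fin n) k → Set} → Unary.Decidable P → Dec (∃ P)
anyVec? {n = n} {k = k} P? =
  map′ (λ a → let v , _ , p = find a in v , p)
       (λ (v , p) → lose (∈-vectors ∈-allFin v) p)
       (ListAny.any? P? (vectors (allFin n) k))

-- One-line notation, with both positions and values numbered from 0.
record Perm (n : ℕ) : Set where
  constructor mkPerm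
  field
    word    : Vec (Fin n) n
    .unique : Unique word

infixl 20 _at_

_at_ : Perm n → Fin n → Fin n
π at i = lookup (Perm.word π) i

unique? : (w : Vec (Fin n) n) → Dec (Unique w)
unique? = allPairs? (λ x y → ¬? (x Fin.≟ y))

at-injective : (π : Perm n) {i j : Fin n} → π at i ≡ π at j → i ≡ j
at-injective (mkPerm w u) = lookup-injective (setoid _) (recompute (unique? w) u) _ _

Perm-≟ : DecidableEquality (Perm n)
Perm-≟ (mkPerm v _) (mkPerm w _) = map′ (λ { refl → refl }) (cong Perm.word) (Vec.≡-dec Fin._≟_ v w)

toPerm : Vec (Fin n) n → Maybe (Perm n)
toPerm w with unique? w
... | yes u = just (mkPerm w u)
... | no _  = nothing

perms : (n : ℕ) → List (Perm n)
perms n = mapMaybe toPerm (vectors (allFin n) n)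

-- (n , π) has length suc n: there is no empty permutation.
𝒫 : Set
𝒫 = Σ ℕ (λ n → Perm (suc n))

len : 𝒫 → ℕ
len (n , _) = suc n

_≟_ : DecidableEquality 𝒫
_≟_ = Product.≡-dec ℕ._≟_ Perm-≟

IsOccurrence : Perm k → Perm n → Vec (Fin n) k → Set
IsOccurrence σ π f =
    (∀ i j → i Fin.< j → lookup f i Fin.< lookup f j)
  × (∀ i j → (σ at i Fin.< σ at j) ⇔ (π at lookup f i Fin.< π at lookup f j))

isOccurrence? : (σ : Perm k) (π : Perm n) → Unary.Decidable (IsOccurrence σ π)
isOccurrence? σ π f =
        all? (λ i → all? λ j → (i Fin.<? j) →-dec (lookup f i Fin.<? lookup f j))
  ×-dec all? (λ i → all? λ j → (σ at i Fin.<? σ at j) ⇔-dec (π at lookup f i Fin.<? π at lookup f j))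

infix 4 _≼_ _≺_ _≼?_ _≺?_ _≟_

_≼_ _≺_ : 𝒫 → 𝒫 → Set
(_ , σ) ≼ (_ , π) = ∃ (IsOccurrence σ π)
σ ≺ π = σ ≼ π × σ ≢ π

_≼?_ : Decidable _≼_
(_ , σ) ≼? (_ , π) = anyVec? (isOccurrence? σ π)

_≺?_ : Decidable _≺_
σ ≺? π = (σ ≼? π) ×-dec ¬? (σ ≟ π)

inInterval? : (σ π : 𝒫) → Unary.Decidable (λ τ → σ ≼ τ × τ ≺ π)
inInterval? σ π τ = (σ ≼? τ) ×-dec (τ ≺? π)

permsUpTo : ℕ → List 𝒫
permsUpTo n = concatMap (λ m → map (m ,_) (perms (suc m))) (upTo (suc n))

-- No pattern of π is longer than π, so the search is exhaustive: see
-- ∈-interval⁺, ∈-interval⁻ and interval-unique.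
interval : 𝒫 → 𝒫 → List 𝒫
interval σ π = filter (inInterval? σ π) (permsUpTo (proj₁ π))

-- By recursion on a bound for the length of the second argument; μ-refl, μ-≺
-- and μ-⋠ below are the defining equations of the Möbius function.
μ-bounded : ℕ → 𝒫 → 𝒫 → ℤ
μ-bounded zero    σ π = 0ℤ
μ-bounded (suc b) σ π =
  if does (σ ≟ π) then 1ℤ else
  if does (σ ≼? π) then - (∑[ τ ← interval σ π ] μ-bounded b σ τ) else
  0ℤ

μ : 𝒫 → 𝒫 → ℤ
μ σ π = μ-bounded (len π) σ π

IsRun : Perm n → Fin n → Fin n → Set
IsRun π a b = a Fin.≤ b × (Steps (λ x y → y ≡ suc x) ⊎ Steps (λ x y → x ≡ suc y))
  where
  Steps : (ℕ → ℕ → Set) → Set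
  Steps R = ∀ i j → a Fin.≤ i → j Fin.≤ b → toℕ j ≡ suc (toℕ i) →
            R (toℕ (π at i)) (toℕ (π at j))

IsAdjacency : Perm n → Fin n → Fin n → Set
IsAdjacency π a b =
  IsRun π a b × (∀ c d → c Fin.≤ a → b Fin.≤ d → IsRun π c d → c ≡ a × d ≡ b)

InTail : Perm n → Fin n → Set
InTail π p = ∃ λ a → ∃ λ b → IsAdjacency π a b × a Fin.< p × p Fin.≤ b

isRun? : (π : Perm n) → Decidable (IsRun π)
isRun? π a b = (a Fin.≤? b) ×-dec (steps? (λ x y → y ℕ.≟ suc x) ⊎-dec steps? (λ x y → x ℕ.≟ suc y))
  where
  steps? : {R : ℕ → ℕ → Set} → Decidable R → Dec _
  steps? R? = all? λ i → all? λ j →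
    (a Fin.≤? i) →-dec ((j Fin.≤? b) →-dec ((toℕ j ℕ.≟ suc (toℕ i)) →-dec
    R? (toℕ (π at i)) (toℕ (π at j))))

isAdjacency? : (π : Perm n) → Decidable (IsAdjacency π)
isAdjacency? π a b = isRun? π a b ×-dec
  all? (λ c → all? λ d → (c Fin.≤? a) →-dec ((b Fin.≤? d) →-dec (isRun? π c d →-dec
  ((c Fin.≟ a) ×-dec (d Fin.≟ b)))))

inTail? : (π : Perm n) → Unary.Decidable (InTail π)
inTail? π p = any? λ a → any? λ b → isAdjacency? π a b ×-dec ((a Fin.<? p) ×-dec (p Fin.≤? b))

-- Fin.zero is the blank entry 0, and the letter π at i appears as
-- Fin.suc (π at i).
Word₀ : ℕ → Set
Word₀ n = Vec (Fin (suc n)) n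

Blank : Word₀ n → Fin n → Set
Blank η p = lookup η p ≡ Fin.zero

blank? : (η : Word₀ n) → Unary.Decidable (Blank η)
blank? η p = lookup η p Fin.≟ Fin.zero

IsEmbedding : Perm k → Perm n → Word₀ n → Set
IsEmbedding {k} {n} σ π η = ∃ λ (f : Vec (Fin n) k) →
    IsOccurrence σ π f
  × (∀ p → p ∈ᵛ f → lookup η p ≡ Fin.suc (π at p))
  × (∀ p → ¬ (p ∈ᵛ f) → Blank η p)

isEmbedding? : (σ : Perm k) (π : Perm n) → Unary.Decidable (IsEmbedding σ π)
isEmbedding? σ π η = anyVec? λ f →
        isOccurrence? σ π f
  ×-dec all? (λ p → (p ∈? f) →-dec (lookup η p Fin.≟ Fin.suc (π at p)))
  ×-dec all? (λ p → ¬? (p ∈? f) →-dec blank? η p)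
  where open VecMembership Fin._≟_ using (_∈?_)

embeddings : Perm k → Perm n → List (Word₀ n)
embeddings {n = n} σ π = filter (isEmbedding? σ π) (vectors (allFin (suc n)) n)

IsNormal : Perm n → Word₀ n → Set
IsNormal π η = ∀ p → InTail π p → ¬ Blank η p

isNormal? : (π : Perm n) → Unary.Decidable (IsNormal π)
isNormal? π η = all? λ p → inTail? π p →-dec ¬? (blank? η p)

NE : 𝒫 → 𝒫 → ℤ
NE (_ , σ) (_ , π) = + length (filter (isNormal? π) (embeddings σ π))

-- The nonzero entries in each adjacency occupy its last positions.  Two
-- embeddings are equivalent when they have equally many nonzero entries in
-- each adjacency, so this selects the rightmost one of each class.
IsRightmost : Perm n → Word₀ n → Set
IsRightmost π η = ∀ a b → IsAdjacency π a b →
  ∀ p q → a Fin.≤ p → p Fin.< q → q Fin.≤ b → ¬ Blank η p → ¬ Blank η q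

isRightmost? : (π : Perm n) → Unary.Decidable (IsRightmost π)
isRightmost? π η = all? λ a → all? λ b → isAdjacency? π a b →-dec
  all? (λ p → all? λ q → (a Fin.≤? p) →-dec ((p Fin.<? q) →-dec ((q Fin.≤? b) →-dec
  (¬? (blank? η p) →-dec ¬? (blank? η q)))))

Ê : Perm k → Perm n → List (Word₀ n)
Ê σ π = filter (isRightmost? π) (embeddings σ π)

Z : Word₀ n → Subset n
Z η = tabulate (λ p → does (blank? η p))

InEZ : List (Word₀ n) → Set
InEZ S = S ≢ [] × ⋂ (map Z S) ≡ Subset.⊥

inEZ? : Unary.Decidable (InEZ {n})
inEZ? S = ¬? (List.≡-dec (Vec.≡-dec Fin._≟_) S []) ×-dec
          Vec.≡-dec Bool._≟_ (⋂ (map Z S)) Subset.⊥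

EZ : 𝒫 → 𝒫 → ℤ
EZ (_ , σ) (_ , π) = ∑[ S ← filter inEZ? (sublists (Ê σ π)) ] (-1ℤ ^ length S)

∈-perms : (π : Perm n) → π ∈ perms n
∈-perms {n} (mkPerm w u) =
  ListAny.mapMaybe⁺ toPerm (vectors (allFin n) n)
    (ListAny.map⁺ (ListAny.map (λ { refl → found }) (∈-vectors ∈-allFin w)))
  where
  found : MaybeAny.Any (mkPerm w u ≡_) (toPerm w)
  found with unique? w
  ... | yes _ = just refl
  ... | no ¬u = contradiction (recompute (unique? w) u) ¬u

private
  increasing⇒injective : (f : Fin m → Fin n) → (∀ i j → i Fin.< j → f i Fin.< f j) →
                         ∀ {i j} → f i ≡ f j → i ≡ j
  increasing⇒injective f inc {i} {j} e with Fin.<-cmp i j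
  ... | tri< i<j _ _ = contradiction e (Fin.<⇒≢ (inc i j i<j))
  ... | tri≈ _ i≡j _ = i≡j
  ... | tri> _ _ j<i = contradiction (sym e) (Fin.<⇒≢ (inc j i j<i))

  ≼⇒≤ : ∀ σ π → σ ≼ π → proj₁ σ ℕ.≤ proj₁ π
  ≼⇒≤ _ _ (f , inc , _) = ℕ.s≤s⁻¹ (Fin.injective⇒≤ (increasing⇒injective (lookup f) inc))

∈-interval⁺ : ∀ σ π τ → σ ≼ τ → τ ≺ π → τ ∈ interval σ π
∈-interval⁺ σ π τ@(m , τ′) σ≼τ τ≺π = ∈-filter⁺ (inInterval? σ π)
  (∈-concatMap⁺ (λ m → map (m ,_) (perms (suc m)))
    (lose (∈-upTo⁺ (s≤s (≼⇒≤ τ π (proj₁ τ≺π)))) (∈-map⁺ (m ,_) (∈-perms τ′))))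
  (σ≼τ , τ≺π)

∈-interval⁻ : ∀ σ π τ → τ ∈ interval σ π → σ ≼ τ × τ ≺ π
∈-interval⁻ σ π τ τ∈ = proj₂ (∈-filter⁻ (inInterval? σ π) {xs = permsUpTo (proj₁ π)} τ∈)

vectors-unique : {xs : List A} → ListUnique.Unique xs → ∀ k → ListUnique.Unique (vectors xs k)
vectors-unique xs! zero    = ListAll.[] ∷ []
vectors-unique xs! (suc k) =
  ListUnique.cartesianProductWith⁺ _∷_ Vec.∷-injective xs! (vectors-unique xs! k)

interval-unique : ∀ σ π → ListUnique.Unique (interval σ π)
interval-unique σ π = ListUnique.filter⁺ (inInterval? σ π)
  (ListUnique.concat⁺ {xss = map ofLength (upTo (suc (proj₁ π)))}
    (ListAll.map⁺ {f = ofLength} (ListAll.universal ofLength-unique (upTo (suc (proj₁ π)))))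
    (ListPairs.map⁺ {f = ofLength} (ListPairs.map disjoint (ListUnique.upTo⁺ (suc (proj₁ π))))))
  where
  ofLength : ℕ → List 𝒫
  ofLength m = map (m ,_) (perms (suc m))

  mapMaybe-toPerm : ∀ {n} (ws : List (Vec (Fin n) n)) →
                    map Perm.word (mapMaybe toPerm ws) ≡ filter unique? ws
  mapMaybe-toPerm []       = refl
  mapMaybe-toPerm (w ∷ ws) with unique? w
  ... | yes _ = cong (w ∷_) (mapMaybe-toPerm ws)
  ... | no  _ = mapMaybe-toPerm ws

  perms-unique : ∀ n → ListUnique.Unique (perms n)
  perms-unique n = ListUnique.map⁻ (subst ListUnique.Unique (sym (mapMaybe-toPerm (vectors (allFin n) n)))
    (ListUnique.filter⁺ unique? (vectors-unique (ListUnique.allFin⁺ n) n)))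

  ofLength-unique : ∀ m → ListUnique.Unique (ofLength m)
  ofLength-unique m = ListUnique.map⁺ (λ { refl → refl }) (perms-unique (suc m))

  disjoint : ∀ {m n} → m ≢ n → Disjoint (ofLength m) (ofLength n)
  disjoint {m} {n} m≢n (x∈ , y∈) with ∈-map⁻ (m ,_) x∈ | ∈-map⁻ (n ,_) y∈
  ... | _ , _ , e | _ , _ , e′ = m≢n (cong proj₁ (trans (sym e) e′))

private
  ≤-increasing : (f : Fin m → Fin n) → (∀ i j → i Fin.< j → f i Fin.< f j) →
                 ∀ t i → toℕ i ≡ t → t ℕ.≤ toℕ (f i)
  ≤-increasing f inc zero    i           _    = z≤n
  ≤-increasing f inc (suc t) (Fin.suc i) refl = ℕ.≤-<-trans
    (≤-increasing f inc t (Fin.inject₁ i) (Fin.toℕ-inject₁ i))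
    (inc (Fin.inject₁ i) (Fin.suc i) (s≤s (ℕ.≤-reflexive (Fin.toℕ-inject₁ i))))

  opposite-< : (i j : Fin n) → i Fin.< j → opposite j Fin.< opposite i
  opposite-< i j i<j = subst₂ ℕ._<_ (sym (Fin.opposite-prop j)) (sym (Fin.opposite-prop i))
    (ℕ.∸-monoʳ-< (s≤s i<j) (Fin.toℕ<n j))

  increasing⇒id : (f : Fin n → Fin n) → (∀ i j → i Fin.< j → f i Fin.< f j) → ∀ i → f i ≡ i
  increasing⇒id f inc i = Fin.toℕ-injective (ℕ.≤-antisym (ℕ.≮⇒≥ i≮fi) (≤-increasing f inc _ i refl))
    where
    f′ : Fin _ → Fin _
    f′ = opposite ∘ f ∘ opposite
    inc′ : ∀ i j → i Fin.< j → f′ i Fin.< f′ j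
    inc′ i j i<j = opposite-< _ _ (inc _ _ (opposite-< i j i<j))
    i≮fi : ¬ (i Fin.< f i)
    i≮fi i<fi = ℕ.<⇒≱ (opposite-< i (f i) i<fi)
      (subst (λ x → toℕ (opposite i) ℕ.≤ toℕ (opposite (f x))) (Fin.opposite-involutive i)
        (≤-increasing f′ inc′ _ (opposite i) refl))

  at-surjective : (π : Perm n) → ∀ v → ∃ λ i → π at i ≡ v
  at-surjective {suc n} π v with any? (λ i → π at i Fin.≟ v)
  ... | yes h = h
  ... | no ∄i = contradiction
    (Fin.injective⇒≤ {f = λ i → Fin.punchOut (v≢ i)}
      (λ e → at-injective π (Fin.punchOut-injective (v≢ _) (v≢ _) e)))
    ℕ.1+n≰n
    where
    v≢ : ∀ i → v ≢ π at i
    v≢ i e = ∄i (i , sym e)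

  sameOrder⇒≡ : (σ π : Perm n) →
                (∀ i j → (σ at i Fin.< σ at j) ⇔ (π at i Fin.< π at j)) → σ ≡ π
  sameOrder⇒≡ σ π iso = ext (trans (sym (tabulate∘lookup _))
    (trans (tabulate-cong at-≡) (tabulate∘lookup _)))
    where
    ext : Perm.word σ ≡ Perm.word π → σ ≡ π
    ext refl = refl
    g : Fin _ → Fin _
    g v = proj₁ (at-surjective π v)
    πg : ∀ v → π at g v ≡ v
    πg v = proj₂ (at-surjective π v)
    σg : ∀ v → σ at g v ≡ v
    σg = increasing⇒id (λ v → σ at g v) λ v w v<w →
      Equivalence.from (iso (g v) (g w)) (subst₂ Fin._<_ (sym (πg v)) (sym (πg w)) v<w)
    at-≡ : ∀ i → σ at i ≡ π at i
    at-≡ i = trans (cong (σ at_) (sym (at-injective π (πg (π at i))))) (σg (π at i))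

≺⇒shorter : ∀ σ π → σ ≺ π → proj₁ σ ℕ.< proj₁ π
≺⇒shorter (m , σ) (n , π) (σ≼π@(f , inc , iso) , σ≢π) = ℕ.≤∧≢⇒< (≼⇒≤ (m , σ) (n , π) σ≼π) m≢n
  where
  m≢n : m ≢ n
  m≢n refl = σ≢π (cong (m ,_) (sameOrder⇒≡ σ π λ i j →
    subst₂ (λ x y → (σ at i Fin.< σ at j) ⇔ (π at x Fin.< π at y))
      (increasing⇒id (lookup f) inc i) (increasing⇒id (lookup f) inc j) (iso i j)))

private
  ∑-cong : {xs : List A} {f g : A → ℤ} → (∀ x → x ∈ xs → f x ≡ g x) → ∑ xs f ≡ ∑ xs g
  ∑-cong eq = cong (foldr _+_ 0ℤ) (List.map-cong-local (ListAll.tabulate (λ {x} → eq x)))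

  μ-bounded-stable : ∀ b c σ π → proj₁ π ℕ.< b → proj₁ π ℕ.< c →
                     μ-bounded b σ π ≡ μ-bounded c σ π
  μ-bounded-stable (suc b) (suc c) σ π (s≤s p) (s≤s q) =
    cong (λ s → if does (σ ≟ π) then 1ℤ else if does (σ ≼? π) then - s else 0ℤ)
      (∑-cong λ τ τ∈ →
        let τ<π = ≺⇒shorter τ π (proj₂ (∈-interval⁻ σ π τ τ∈))
        in μ-bounded-stable b c σ τ (ℕ.<-≤-trans τ<π p) (ℕ.<-≤-trans τ<π q))

  if-yes : {x y : ℤ} (d : Dec A) → A → (if does d then x else y) ≡ x
  if-yes d a = cong (λ b → if b then _ else _) (dec-true d a)

  if-no : {x y : ℤ} (d : Dec A) → ¬ A → (if does d then x else y) ≡ y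
  if-no d ¬a = cong (λ b → if b then _ else _) (dec-false d ¬a)

μ-refl : ∀ σ → μ σ σ ≡ 1ℤ
μ-refl σ = if-yes (σ ≟ σ) refl

μ-≺ : ∀ σ π → σ ≺ π → μ σ π ≡ - (∑[ τ ← interval σ π ] μ σ τ)
μ-≺ σ π (σ≼π , σ≢π) =
  trans (if-no (σ ≟ π) σ≢π) (trans (if-yes (σ ≼? π) σ≼π)
    (cong -_ (∑-cong λ τ τ∈ →
      μ-bounded-stable (proj₁ π) (len τ) σ τ
        (≺⇒shorter τ π (proj₂ (∈-interval⁻ σ π τ τ∈))) ℕ.≤-refl)))

≼-refl : ∀ σ → σ ≼ σ
≼-refl (n , σ) = tabulate id
  , (λ i j → subst₂ Fin._<_ (sym (lookup∘tabulate id i)) (sym (lookup∘tabulate id j)))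
  , (λ i j → subst₂ (λ x y → (σ at i Fin.< σ at j) ⇔ (σ at x Fin.< σ at y))
      (sym (lookup∘tabulate id i)) (sym (lookup∘tabulate id j)) (mk⇔ id id))

μ-⋠ : ∀ σ π → ¬ (σ ≼ π) → μ σ π ≡ 0ℤ
μ-⋠ σ π σ⋠π =
  trans (if-no (σ ≟ π) (λ { refl → σ⋠π (≼-refl σ) })) (if-no (σ ≼? π) σ⋠π)

{-# OPTIONS --safe #-}
module Submission where

-- A rightmost word w, given by how many letters it keeps in each adjacency of π, is a point of a
-- product of chains C whose top is π itself, and a permutation ρ lies below the pattern of w iff
-- some rightmost embedding η of ρ satisfies η ≤ w in C.  The condition in EZ says that the join of
-- S is the top of C.  Möbius inversion on C turns it into "every η in S lies below w", and summing
-- over S gives EZ(ρ, π) = − Σ_w μ_C(w, top) [ρ ≤ pattern of w].  Exchanging the sums in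
-- Σ_ρ μ(σ, ρ) EZ(ρ, π), the defining recurrence of μ leaves −μ_C(w, top) for each w ≠ top with
-- pattern σ, and μ(σ, π) for w = top.  Finally μ_C(w, top) is (-1)^(number of blanks of w) if w is
-- normal and 0 otherwise, so the former terms add up to −(-1)^(|π|−|σ|) NE(σ, π).

open import Defs
import Algebra.Properties.CommutativeMonoid.Sum as CommutativeMonoidSum
open import Data.Bool.Base using (true; false; if_then_else_)
open import Data.Fin.Base as Fin using (Fin; toℕ; punchIn; punchOut)
open import Data.Fin.Properties as Fin using (all?; any?; ¬∀⟶∃¬)
import Data.Fin.Subset as Subset
import Data.Fin.Subset.Properties as Subset
open import Data.Integer.Base as ℤ using (ℤ; _+_; _*_; -_; _^_; 0ℤ; 1ℤ; -1ℤ)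
import Data.Integer.Properties as ℤ
open import Data.Integer.Tactic.RingSolver using (solve-∀)
open import Data.List.Base using (List; []; _∷_; map; _++_; filter; length; allFin; cartesianProductWith)
open import Data.List.Membership.Propositional using (_∈_; find; lose)
open import Data.List.Membership.Propositional.Properties using (∈-allFin; ∈-filter⁺; ∈-filter⁻; ∈-++⁻; ∈-map⁻)
open import Data.List.Membership.Propositional.Properties.WithK using (unique∧set⇒bag)
open import Data.List.Relation.Binary.BagAndSetEquality using (∼bag⇒↭)
open import Data.List.Relation.Binary.Permutation.Propositional as ↭ using (_↭_)
open import Data.List.Relation.Unary.All as All using (All; []; _∷_)
import Data.List.Relation.Unary.All.Properties as All
open import Data.List.Relation.Unary.AllPairs using ([]; _∷_)
open import Data.List.Relation.Unary.Any as Any using (Any; here; there)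
open import Data.List.Relation.Unary.Unique.Propositional using (Unique)
import Data.List.Relation.Unary.Unique.Propositional.Properties as Unique
open import Data.Nat.Base as ℕ using (ℕ; zero; suc; ∣_-_∣)
open import Data.Nat.Induction using (<-wellFounded)
import Data.Nat.Properties as ℕ
open import Data.Product.Base using (∃; _×_; _,_; proj₁; proj₂)
open import Data.Sum.Base as Sum using (_⊎_; inj₁; inj₂; fromInj₂)
open import Data.Vec.Base as Vec using (Vec; []; _∷_; lookup; tabulate; _[_]≔_)
import Data.Vec.Membership.DecPropositional as DecMembership
open import Data.Vec.Membership.Propositional using () renaming (_∈_ to _∈ᵛ_)
open import Data.Vec.Membership.Propositional.Properties using (∈-lookup)
import Data.Vec.Properties as Vec
import Data.Vec.Relation.Unary.All as AllVec
import Data.Vec.Relation.Unary.AllPairs as AllPairsVec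
import Data.Vec.Relation.Unary.Any as AnyVec
import Data.Vec.Relation.Unary.Any.Properties as AnyVec
import Data.Vec.Relation.Unary.Unique.Propositional as UniqueVec
import Data.Vec.Relation.Unary.Unique.Propositional.Properties as UniqueVec
open import Function.Base using (_∘_; id)
open import Function.Bundles using (_⇔_; mk⇔; Equivalence)
open import Induction.WellFounded using (Acc; acc)
open import Relation.Binary.Definitions using (DecidableEquality; tri<; tri≈; tri>)
open import Relation.Binary.PropositionalEquality
open import Relation.Nullary.Decidable using (Dec; yes; no; does; ¬?; _×-dec_; _→-dec_; dec-true; dec-false; decidable-stable; map′)
open import Relation.Nullary.Negation using (¬_; contradiction)
open import Relation.Unary using (Decidable)

private
  variable
    A B : Set
    P : A → Set
    k m n : ℕ
    xs ys : List A

-- Indicators and finite sums of integers.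

𝟙 : Dec A → ℤ
𝟙 a? = if does a? then 1ℤ else 0ℤ

𝟙-yes : (a? : Dec A) → A → 𝟙 a? ≡ 1ℤ
𝟙-yes a? a = cong (λ b → if b then 1ℤ else 0ℤ) (dec-true a? a)

𝟙-no : (a? : Dec A) → ¬ A → 𝟙 a? ≡ 0ℤ
𝟙-no a? ¬a = cong (λ b → if b then 1ℤ else 0ℤ) (dec-false a? ¬a)

𝟙-cong : (a? : Dec A) (b? : Dec B) → (A → B) → (B → A) → 𝟙 a? ≡ 𝟙 b?
𝟙-cong a? (yes b) f g = 𝟙-yes a? (g b)
𝟙-cong a? (no ¬b) f g = 𝟙-no a? (¬b ∘ f)

∑-cong : (xs : List A) {f g : A → ℤ} → (∀ {x} → x ∈ xs → f x ≡ g x) → ∑ xs f ≡ ∑ xs g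
∑-cong []       f≗g = refl
∑-cong (x ∷ xs) f≗g = cong₂ _+_ (f≗g (here refl)) (∑-cong xs (f≗g ∘ there))

∑-map : (f : B → ℤ) (g : A → B) (xs : List A) → ∑ (map g xs) f ≡ ∑ xs (f ∘ g)
∑-map f g []       = refl
∑-map f g (x ∷ xs) = cong (f (g x) +_) (∑-map f g xs)

∑-++ : (f : A → ℤ) (xs ys : List A) → ∑ (xs ++ ys) f ≡ ∑ xs f + ∑ ys f
∑-++ f []       ys = sym (ℤ.+-identityˡ _)
∑-++ f (x ∷ xs) ys = trans (cong (f x +_) (∑-++ f xs ys)) (sym (ℤ.+-assoc (f x) _ _))

∑-zero : (xs : List A) → ∑ xs (λ _ → 0ℤ) ≡ 0ℤ
∑-zero []       = refl
∑-zero (x ∷ xs) = trans (ℤ.+-identityˡ _) (∑-zero xs)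

∑-+ : (f g : A → ℤ) (xs : List A) → ∑ xs (λ x → f x + g x) ≡ ∑ xs f + ∑ xs g
∑-+ f g []       = refl
∑-+ f g (x ∷ xs) = trans (cong (f x + g x +_) (∑-+ f g xs)) (interchange (f x) (g x) (∑ xs f) (∑ xs g))
  where
  interchange : ∀ a b c d → (a + b) + (c + d) ≡ (a + c) + (b + d)
  interchange = solve-∀

∑-*ˡ : ∀ c (f : A → ℤ) xs → ∑ xs (λ x → c * f x) ≡ c * ∑ xs f
∑-*ˡ c f []       = sym (ℤ.*-zeroʳ c)
∑-*ˡ c f (x ∷ xs) = trans (cong (c * f x +_) (∑-*ˡ c f xs)) (sym (ℤ.*-distribˡ-+ c _ _))

∑-*ʳ : ∀ c (f : A → ℤ) xs → ∑ xs (λ x → f x * c) ≡ ∑ xs f * c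
∑-*ʳ c f []       = refl
∑-*ʳ c f (x ∷ xs) = trans (cong (f x * c +_) (∑-*ʳ c f xs)) (sym (ℤ.*-distribʳ-+ c (f x) _))

∑-neg : (f : A → ℤ) (xs : List A) → ∑ xs (λ x → - f x) ≡ - ∑ xs f
∑-neg f []       = refl
∑-neg f (x ∷ xs) = trans (cong (- f x +_) (∑-neg f xs)) (sym (ℤ.neg-distrib-+ (f x) _))

∑-swap : (f : A → B → ℤ) (xs : List A) (ys : List B) →
         ∑[ x ← xs ] (∑[ y ← ys ] f x y) ≡ ∑[ y ← ys ] (∑[ x ← xs ] f x y)
∑-swap f []       ys = sym (∑-zero ys)
∑-swap f (x ∷ xs) ys =
  trans (cong (∑ ys (f x) +_) (∑-swap f xs ys)) (sym (∑-+ (f x) (λ y → ∑ xs (λ x → f x y)) ys))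

∑-filter : (P? : Decidable P) (f : A → ℤ) (xs : List A) →
           ∑ (filter P? xs) f ≡ ∑ xs (λ x → 𝟙 (P? x) * f x)
∑-filter P? f []       = refl
∑-filter P? f (x ∷ xs) with P? x
... | yes _ = cong₂ _+_ (sym (ℤ.*-identityˡ (f x))) (∑-filter P? f xs)
... | no _  = trans (∑-filter P? f xs) (sym (ℤ.+-identityˡ _))

length-∑ : (xs : List A) → ℤ.+ length xs ≡ ∑ xs (λ _ → 1ℤ)
length-∑ []       = refl
length-∑ (x ∷ xs) = cong (1ℤ +_) (length-∑ xs)

∑-↭ : (f : A → ℤ) → xs ↭ ys → ∑ xs f ≡ ∑ ys f
∑-↭ f ↭.refl          = refl
∑-↭ f (↭.prep x p)    = cong (f x +_) (∑-↭ f p)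
∑-↭ f (↭.swap x y p)  = trans (cong (λ z → f x + (f y + z)) (∑-↭ f p)) (exchange (f x) (f y) _)
  where
  exchange : ∀ a b c → a + (b + c) ≡ b + (a + c)
  exchange = solve-∀
∑-↭ f (↭.trans p q)   = trans (∑-↭ f p) (∑-↭ f q)

∑-sameElements : (f : A → ℤ) → Unique xs → Unique ys →
                 (∀ {x} → x ∈ xs → x ∈ ys) → (∀ {x} → x ∈ ys → x ∈ xs) → ∑ xs f ≡ ∑ ys f
∑-sameElements f xs! ys! to from =
  ∑-↭ f (∼bag⇒↭ (unique∧set⇒bag xs! ys! (mk⇔ to from)))

∑-delta : (_≟′_ : DecidableEquality A) (f : A → ℤ) {y : A} → Unique xs → y ∈ xs →
          ∑ xs (λ x → 𝟙 (x ≟′ y) * f x) ≡ f y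
∑-delta {xs = x ∷ xs} _≟′_ f {y} (x∉xs ∷ xs!) (here refl) = trans
  (cong₂ _+_
    (trans (cong (_* f x) (𝟙-yes (x ≟′ x) refl)) (ℤ.*-identityˡ (f x)))
    (trans (∑-cong xs (λ {z} z∈ → cong (_* f z) (𝟙-no (z ≟′ x) (All.lookup x∉xs z∈ ∘ sym)))) (∑-zero xs)))
  (ℤ.+-identityʳ (f x))
∑-delta {xs = x ∷ xs} _≟′_ f {y} (x∉xs ∷ xs!) (there y∈) = trans
  (cong₂ _+_ (cong (_* f x) (𝟙-no (x ≟′ y) (All.lookup x∉xs y∈))) (∑-delta _≟′_ f xs! y∈))
  (ℤ.+-identityˡ (f y))

∑-cartesianProductWith : {C : Set} (h : A → B → C) (f : C → ℤ) (xs : List A) (ys : List B) →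
  ∑ (cartesianProductWith h xs ys) f ≡ ∑[ x ← xs ] (∑[ y ← ys ] f (h x y))
∑-cartesianProductWith h f []       ys = refl
∑-cartesianProductWith h f (x ∷ xs) ys = trans (∑-++ f (map (h x) ys) _)
  (cong₂ _+_ (∑-map f (h x) ys) (∑-cartesianProductWith h f xs ys))

-- Finite products, sums over words, alternating sums over sublists.

open CommutativeMonoidSum ℤ.*-1-commutativeMonoid using ()
  renaming (sum to ∏; sum-cong-≗ to ∏-cong; ∑-distrib-+ to ∏-*)

∏-1 : (f : Fin n → ℤ) → (∀ i → f i ≡ 1ℤ) → ∏ f ≡ 1ℤ
∏-1 {zero}  f f≗1 = refl
∏-1 {suc n} f f≗1 = cong₂ _*_ (f≗1 Fin.zero) (∏-1 (f ∘ Fin.suc) (f≗1 ∘ Fin.suc))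

∏-zero : (i : Fin n) (a : Fin n → ℤ) → a i ≡ 0ℤ → ∏ a ≡ 0ℤ
∏-zero Fin.zero    a e = cong (_* ∏ (a ∘ Fin.suc)) e
∏-zero (Fin.suc i) a e = trans (cong (a Fin.zero *_) (∏-zero i (a ∘ Fin.suc) e)) (ℤ.*-zeroʳ (a Fin.zero))

∏-𝟙 : {P : Fin n → Set} (P? : Decidable P) (∀P? : Dec (∀ i → P i)) → ∏ (λ i → 𝟙 (P? i)) ≡ 𝟙 ∀P?
∏-𝟙 P? (yes p) = ∏-1 _ (λ i → 𝟙-yes (P? i) (p i))
∏-𝟙 P? (no ¬p) = let i , ¬pᵢ = ¬∀⟶∃¬ _ _ P? ¬p in ∏-zero i _ (𝟙-no (P? i) ¬pᵢ)

-- The distributive law, applied one position at a time. It expands a condition that factors over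
-- positions into a sum over words.
∑-vectors : (xs : List A) (a : Fin k → A → ℤ) →
            ∑ (vectors xs k) (λ v → ∏ (λ i → a i (lookup v i))) ≡ ∏ (λ i → ∑ xs (a i))
∑-vectors {k = zero}  xs a = refl
∑-vectors {k = suc k} xs a = begin
  ∑ (cartesianProductWith _∷_ xs (vectors xs k)) F
    ≡⟨ ∑-cartesianProductWith _∷_ F xs (vectors xs k) ⟩
  (∑[ x ← xs ] (∑[ v ← vectors xs k ] (a Fin.zero x * G v)))
    ≡⟨ ∑-cong xs (λ {x} _ → ∑-*ˡ (a Fin.zero x) G (vectors xs k)) ⟩
  (∑[ x ← xs ] (a Fin.zero x * ∑ (vectors xs k) G))
    ≡⟨ ∑-*ʳ (∑ (vectors xs k) G) (a Fin.zero) xs ⟩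
  ∑ xs (a Fin.zero) * ∑ (vectors xs k) G
    ≡⟨ cong (∑ xs (a Fin.zero) *_) (∑-vectors xs (a ∘ Fin.suc)) ⟩
  ∏ (λ i → ∑ xs (a i)) ∎
  where
  open ≡-Reasoning
  F : Vec _ (suc k) → ℤ
  F v = ∏ (λ i → a i (lookup v i))
  G : Vec _ k → ℤ
  G v = ∏ (λ i → a (Fin.suc i) (lookup v i))

-- A head that satisfies `P` cancels everything, because adding it to a sublist flips the sign and
-- leaves the condition unchanged. If no entry satisfies `P`, only the empty sublist contributes,
-- and it gives the `1`.
∑-sublists-all : (P? : Decidable P) (xs : List A) →
  ∑[ S ← sublists xs ] (-1ℤ ^ length S * 𝟙 (All.all? P? S)) ≡ 1ℤ + - 𝟙 (Any.any? P? xs)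
∑-sublists-all P? []       = refl
∑-sublists-all P? (x ∷ xs) = trans (∑-++ F (map (x ∷_) (sublists xs)) (sublists xs))
  (trans (cong (_+ ∑ (sublists xs) F) (∑-map F (x ∷_) (sublists xs))) rest)
  where
  F : List _ → ℤ
  F S = -1ℤ ^ length S * 𝟙 (All.all? P? S)
  rest : ∑ (sublists xs) (F ∘ (x ∷_)) + ∑ (sublists xs) F ≡ 1ℤ + - 𝟙 (Any.any? P? (x ∷ xs))
  rest with P? x
  ... | yes px = trans (cong (_+ ∑ (sublists xs) F)
      (trans (∑-cong (sublists xs) (λ {S} _ → negate (-1ℤ ^ length S) (𝟙 (All.all? P? S))))
        (∑-neg F (sublists xs))))
      (ℤ.+-inverseˡ (∑ (sublists xs) F))
    where
    negate : ∀ a b → -1ℤ * a * b ≡ - (a * b)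
    negate a b = trans (ℤ.*-assoc -1ℤ a b) (ℤ.-1*i≡-i (a * b))
  ... | no ¬px = trans (cong₂ _+_
      (trans (∑-cong (sublists xs) (λ {S} _ → ℤ.*-zeroʳ (-1ℤ * -1ℤ ^ length S))) (∑-zero (sublists xs)))
      (∑-sublists-all P? xs))
      (ℤ.+-identityˡ _)

-- Occurrences and the pattern order.

open Equivalence using (to; from)

increasing-injective : (f : Fin m → Fin n) → (∀ i j → i Fin.< j → f i Fin.< f j) →
                       ∀ {i j} → f i ≡ f j → i ≡ j
increasing-injective f inc {i} {j} e with Fin.<-cmp i j
... | tri< i<j _ _ = contradiction e (Fin.<⇒≢ (inc i j i<j))
... | tri≈ _ i≡j _ = i≡j
... | tri> _ _ j<i = contradiction (sym e) (Fin.<⇒≢ (inc j i j<i))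

increasing-cancel : (f : Fin m → Fin n) → (∀ i j → i Fin.< j → f i Fin.< f j) →
                    ∀ {i j} → f i Fin.< f j → i Fin.< j
increasing-cancel f inc {i} {j} fi<fj with Fin.<-cmp i j
... | tri< i<j _ _ = i<j
... | tri≈ _ refl _ = contradiction fi<fj (ℕ.<-irrefl refl)
... | tri> _ _ j<i = contradiction (inc j i j<i) (ℕ.<-asym fi<fj)

tabulate-occurrence : (σ : Perm k) (π : Perm n) (f : Fin k → Fin n) →
  (∀ i j → i Fin.< j → f i Fin.< f j) →
  (∀ i j → (σ at i Fin.< σ at j) ⇔ (π at f i Fin.< π at f j)) →
  IsOccurrence σ π (tabulate f)
tabulate-occurrence σ π f inc iso =
    (λ i j i<j → subst₂ Fin._<_ (sym (Vec.lookup∘tabulate f i)) (sym (Vec.lookup∘tabulate f j)) (inc i j i<j))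
  , (λ i j → subst₂ (λ x y → (σ at i Fin.< σ at j) ⇔ (π at x Fin.< π at y))
      (sym (Vec.lookup∘tabulate f i)) (sym (Vec.lookup∘tabulate f j)) (iso i j))

occurrence-∘ : (ρ : Perm k) (σ : Perm m) (π : Perm n) (f : Vec (Fin n) m) (g : Vec (Fin m) k) →
  IsOccurrence σ π f → IsOccurrence ρ σ g → IsOccurrence ρ π (tabulate (lookup f ∘ lookup g))
occurrence-∘ ρ σ π f g (f-inc , f-iso) (g-inc , g-iso) = tabulate-occurrence ρ π _
  (λ i j i<j → f-inc _ _ (g-inc i j i<j))
  (λ i j → mk⇔ (to (f-iso _ _) ∘ to (g-iso i j)) (from (g-iso i j) ∘ from (f-iso _ _)))

-- An occurrence preserves and reflects the order of positions and of letters, so `g` can be pulled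
-- back along `f`.
occurrence-factor : (ρ : Perm k) (σ : Perm m) (π : Perm n) (f : Vec (Fin n) m) (g : Vec (Fin n) k) →
  IsOccurrence σ π f → IsOccurrence ρ π g → (∀ i → ∃ λ j → lookup f j ≡ lookup g i) →
  ∃ (IsOccurrence ρ σ)
occurrence-factor ρ σ π f g (f-inc , f-iso) (g-inc , g-iso) g⊆f = tabulate h , tabulate-occurrence ρ σ h
  (λ i j i<j → increasing-cancel (lookup f) f-inc
    (subst₂ Fin._<_ (sym (f∘h i)) (sym (f∘h j)) (g-inc i j i<j)))
  (λ i j → mk⇔
    (λ ρ< → from (f-iso (h i) (h j))
      (subst₂ (λ x y → π at x Fin.< π at y) (sym (f∘h i)) (sym (f∘h j)) (to (g-iso i j) ρ<)))
    (λ σ< → from (g-iso i j)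
      (subst₂ (λ x y → π at x Fin.< π at y) (f∘h i) (f∘h j) (to (f-iso (h i) (h j)) σ<))))
  where
  h : Fin _ → Fin _
  h i = proj₁ (g⊆f i)
  f∘h : ∀ i → lookup f (h i) ≡ lookup g i
  f∘h i = proj₂ (g⊆f i)

≼-trans : ∀ ρ σ π → ρ ≼ σ → σ ≼ π → ρ ≼ π
≼-trans (_ , ρ) (_ , σ) (_ , π) (g , g-occ) (f , f-occ) =
  tabulate (lookup f ∘ lookup g) , occurrence-∘ ρ σ π f g f-occ g-occ

≼-antisym : ∀ σ π → σ ≼ π → π ≼ σ → σ ≡ π
≼-antisym σ π σ≼π π≼σ with σ ≟ π
... | yes σ≡π = σ≡π
... | no σ≢π  = contradiction (≺⇒shorter σ π (σ≼π , σ≢π)) (ℕ.<-asym (≺⇒shorter π σ (π≼σ , σ≢π ∘ sym)))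

-- Deleting letters and standardising.

at-punchIn-≢ : (π : Perm (suc n)) (p : Fin (suc n)) → ∀ i → π at p ≢ π at punchIn p i
at-punchIn-≢ π p i e = Fin.punchInᵢ≢i p i (sym (at-injective π e))

delete : Perm (suc n) → Fin (suc n) → Perm n
delete π p = mkPerm
  (tabulate (λ i → punchOut (π-≢ i)))
  (UniqueVec.tabulate⁺ (λ e →
    Fin.punchIn-injective p _ _ (at-injective π (Fin.punchOut-injective (π-≢ _) (π-≢ _) e))))
  where π-≢ = at-punchIn-≢ π p

delete-occurrence : (π : Perm (suc n)) (p : Fin (suc n)) →
                    IsOccurrence (delete π p) π (tabulate (punchIn p))
delete-occurrence π p = tabulate-occurrence (delete π p) π (punchIn p)
  (λ i j i<j → ℕ.≰⇒> (ℕ.<⇒≱ i<j ∘ Fin.punchIn-cancel-≤ p j i))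
  (λ i j → subst₂ (λ x y → (x Fin.< y) ⇔ (π at punchIn p i Fin.< π at punchIn p j))
    (sym (Vec.lookup∘tabulate _ i)) (sym (Vec.lookup∘tabulate _ j))
    (mk⇔ (λ < → ℕ.≰⇒> (ℕ.<⇒≱ < ∘ Fin.punchOut-mono-≤ (π-≢ j) (π-≢ i)))
         (λ < → ℕ.≰⇒> (ℕ.<⇒≱ < ∘ Fin.punchOut-cancel-≤ (π-≢ j) (π-≢ i)))))
  where π-≢ = at-punchIn-≢ π p

-- Positions that fail `P` are deleted one at a time until all the remaining ones satisfy it. The
-- pattern left over may be empty, so it is returned as a `Perm k` and not as an element of `𝒫`.
standardise : (π : Perm n) {P : Fin n → Set} → Decidable P →
  ∃ λ k → ∃ λ (τ : Perm k) → ∃ λ f → IsOccurrence τ π f ×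
  (∀ i → P (lookup f i)) × (∀ p → P p → ∃ λ i → lookup f i ≡ p)
standardise {zero}  π P? = zero , π , [] , ((λ ()) , (λ ())) , (λ ()) , (λ ())
standardise {suc n} π {P} P? with all? P?
... | yes all = suc n , π , tabulate id
  , tabulate-occurrence π π id (λ _ _ i<j → i<j) (λ _ _ → mk⇔ id id)
  , (λ i → all _) , (λ p _ → p , Vec.lookup∘tabulate id p)
... | no ¬all =
  let p , ¬Pp = ¬∀⟶∃¬ _ _ P? ¬all
      k , τ , f , occ , f⊆P , P⊆f = standardise (delete π p) (P? ∘ punchIn p)
      h = lookup (tabulate (punchIn p)) ∘ lookup f
      lookup-≡ = λ i → trans (Vec.lookup∘tabulate h i) (Vec.lookup∘tabulate (punchIn p) (lookup f i))
  in k , τ , tabulate h , occurrence-∘ τ (delete π p) π (tabulate (punchIn p)) f (delete-occurrence π p) occ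
  , (λ i → subst P (sym (lookup-≡ i)) (f⊆P i))
  , λ q Pq →
      let p≢q = λ (e : p ≡ q) → ¬Pp (subst P (sym e) Pq)
          i , fi≡ = P⊆f (punchOut p≢q) (subst P (sym (Fin.punchIn-punchOut p≢q)) Pq)
      in i , trans (lookup-≡ i) (trans (cong (punchIn p) fi≡) (Fin.punchIn-punchOut p≢q))


-- Sums over intervals and the recurrence of `μ`.

-- An element of the interval would give `σ ≺ π` by transitivity and antisymmetry, so the interval
-- is empty. This serves both `σ ≡ π` and `σ` not below `π`.
∑-interval-⊀ : ∀ σ π (f : 𝒫 → ℤ) → ¬ (σ ≺ π) → ∑ (interval σ π) f ≡ 0ℤ
∑-interval-⊀ σ π f σ⊀π = trans
  (∑-cong (interval σ π) (λ {ρ} ρ∈ →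
    let σ≼ρ , ρ≼π , ρ≢π = ∈-interval⁻ σ π ρ ρ∈
    in contradiction (≼-trans σ ρ π σ≼ρ ρ≼π , λ { refl → ρ≢π (≼-antisym ρ σ ρ≼π σ≼ρ) }) σ⊀π))
  (∑-zero (interval σ π))

-- Within `[σ, π)` the condition `ρ ≼ τ` cuts out the closed interval `[σ, τ]`, and the recurrence
-- makes `μ σ` sum to zero over it unless `σ ≡ τ`. If `σ` is not below `τ`, both sides vanish.
∑-interval-below : ∀ σ τ π → τ ≺ π →
                   ∑[ ρ ← interval σ π ] (𝟙 (ρ ≼? τ) * μ σ ρ) ≡ 𝟙 (σ ≟ τ)
∑-interval-below σ τ π τ≺π@(τ≼π , τ≢π) = by-cases (σ ≼? τ)
  where
  by-cases : Dec (σ ≼ τ) → ∑[ ρ ← interval σ π ] (𝟙 (ρ ≼? τ) * μ σ ρ) ≡ 𝟙 (σ ≟ τ)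
  by-cases (no σ⋠τ) = trans
    (trans (∑-cong (interval σ π) (λ {ρ} ρ∈ → cong (_* μ σ ρ) (𝟙-no (ρ ≼? τ) (λ ρ≼τ →
      σ⋠τ (≼-trans σ ρ τ (proj₁ (∈-interval⁻ σ π ρ ρ∈)) ρ≼τ))))) (∑-zero (interval σ π)))
    (sym (𝟙-no (σ ≟ τ) (λ { refl → σ⋠τ (≼-refl σ) })))
  by-cases (yes σ≼τ) = begin
    (∑[ ρ ← interval σ π ] (𝟙 (ρ ≼? τ) * μ σ ρ))
      ≡⟨ ∑-filter (_≼? τ) (μ σ) (interval σ π) ⟨
    ∑ (filter (_≼? τ) (interval σ π)) (μ σ)
      ≡⟨ ∑-sameElements (μ σ) (Unique.filter⁺ (_≼? τ) (interval-unique σ π))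
           (All.tabulate (λ ρ∈ τ≡ρ → proj₂ (proj₂ (∈-interval⁻ σ τ _ ρ∈)) (sym τ≡ρ)) ∷ interval-unique σ τ)
           ⊆→ ⊆← ⟩
    μ σ τ + ∑ (interval σ τ) (μ σ)
      ≡⟨ closed (σ ≟ τ) ⟩
    𝟙 (σ ≟ τ) ∎
    where
    open ≡-Reasoning
    ⊆→ : ∀ {ρ} → ρ ∈ filter (_≼? τ) (interval σ π) → ρ ∈ τ ∷ interval σ τ
    ⊆→ {ρ} ρ∈ =
      let ρ∈′ , ρ≼τ = ∈-filter⁻ (_≼? τ) {xs = interval σ π} ρ∈
          σ≼ρ , _   = ∈-interval⁻ σ π ρ ρ∈′
      in head-or-tail σ≼ρ ρ≼τ (ρ ≟ τ)
      where
      head-or-tail : σ ≼ ρ → ρ ≼ τ → Dec (ρ ≡ τ) → ρ ∈ τ ∷ interval σ τ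
      head-or-tail σ≼ρ ρ≼τ (yes ρ≡τ) = here ρ≡τ
      head-or-tail σ≼ρ ρ≼τ (no ρ≢τ)  = there (∈-interval⁺ σ τ ρ σ≼ρ (ρ≼τ , ρ≢τ))
    ⊆← : ∀ {ρ} → ρ ∈ τ ∷ interval σ τ → ρ ∈ filter (_≼? τ) (interval σ π)
    ⊆← (here refl) = ∈-filter⁺ (_≼? τ) (∈-interval⁺ σ π τ σ≼τ τ≺π) (≼-refl τ)
    ⊆← {ρ} (there ρ∈) =
      let σ≼ρ , ρ≼τ , ρ≢τ = ∈-interval⁻ σ τ ρ ρ∈
      in ∈-filter⁺ (_≼? τ) (∈-interval⁺ σ π ρ σ≼ρ (≼-trans ρ τ π ρ≼τ τ≼π ,
           λ { refl → ρ≢τ (≼-antisym ρ τ ρ≼τ τ≼π) })) ρ≼τ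
    closed : (d : Dec (σ ≡ τ)) → μ σ τ + ∑ (interval σ τ) (μ σ) ≡ 𝟙 d
    closed (no σ≢τ)   = trans (cong (_+ ∑ (interval σ τ) (μ σ)) (μ-≺ σ τ (σ≼τ , σ≢τ)))
                              (ℤ.+-inverseˡ (∑ (interval σ τ) (μ σ)))
    closed (yes refl) = cong₂ _+_ (μ-refl σ) (∑-interval-⊀ σ σ (μ σ) (λ (_ , σ≢σ) → σ≢σ refl))

-- Words, their order and their weights.

words : (n : ℕ) → List (Word₀ n)
words n = vectors (allFin (suc n)) n

∈-words : (w : Word₀ n) → w ∈ words n
∈-words w = ∈-vectors ∈-allFin w

-- On rightmost words this is the product order of the chains: blanks fill the start of each
-- adjacency, so inclusion of blanks compares the numbers of letters kept.
_⊑_ : Word₀ n → Word₀ n → Set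
η ⊑ w = ∀ i → Blank w i → Blank η i

_⊑?_ : (η w : Word₀ n) → Dec (η ⊑ w)
η ⊑? w = all? λ i → blank? w i →-dec blank? η i

Faithful : Perm n → Word₀ n → Set
Faithful π w = ∀ i → ¬ Blank w i → lookup w i ≡ Fin.suc (π at i)

-- The weight is the Möbius function μ(w, π) of the product of chains formed by
-- the rightmost words, extended by zero to all words.
coefficient : Perm n → Fin n → Fin (suc n) → ℤ
coefficient π i x = 𝟙 (x Fin.≟ Fin.suc (π at i)) + - 𝟙 (¬? (inTail? π i)) * 𝟙 (x Fin.≟ Fin.zero)

weight : Perm n → Word₀ n → ℤ
weight π w = ∏ (λ i → coefficient π i (lookup w i))

coefficient-letter : (π : Perm n) (i : Fin n) → coefficient π i (Fin.suc (π at i)) ≡ 1ℤ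
coefficient-letter π i = cong₂ _+_ (𝟙-yes (Fin.suc (π at i) Fin.≟ Fin.suc (π at i)) refl)
  (ℤ.*-zeroʳ (- 𝟙 (¬? (inTail? π i))))

coefficient-blank : (π : Perm n) (i : Fin n) → coefficient π i Fin.zero ≡ - 𝟙 (¬? (inTail? π i))
coefficient-blank π i = trans (ℤ.+-identityˡ _) (ℤ.*-identityʳ _)

-- A single position with a wrong letter, or with a blank in a tail, gives a zero factor. Weighted
-- sums over all words can therefore treat each word as faithful and normal.
weight-support : (π : Perm n) (w : Word₀ n) → (Faithful π w × IsNormal π w) ⊎ weight π w ≡ 0ℤ
weight-support {n} π w = by-cases (all? admissible?)
  where
  Admissible : Fin n → Set
  Admissible i = (¬ Blank w i → lookup w i ≡ Fin.suc (π at i)) × (InTail π i → ¬ Blank w i)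
  admissible? : Decidable Admissible
  admissible? i = (¬? (blank? w i) →-dec (lookup w i Fin.≟ Fin.suc (π at i)))
            ×-dec (inTail? π i →-dec ¬? (blank? w i))
  vanishes : ∀ i → ¬ Admissible i → (b : Dec (Blank w i)) (t : Dec (InTail π i)) →
             coefficient π i (lookup w i) ≡ 0ℤ
  vanishes i ¬adm (yes b) (no ∉tail) = contradiction ((λ ¬b → contradiction b ¬b) , (λ ∈tail _ → ∉tail ∈tail)) ¬adm
  vanishes i ¬adm (yes b) (yes ∈tail) = trans (cong (coefficient π i) b)
    (trans (coefficient-blank π i) (cong -_ (𝟙-no (¬? (inTail? π i)) (λ ∉tail → ∉tail ∈tail))))
  vanishes i ¬adm (no ¬b) _ = cong₂ _+_
    (𝟙-no (lookup w i Fin.≟ Fin.suc (π at i)) (λ e → ¬adm ((λ _ → e) , (λ _ → ¬b))))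
    (trans (cong (- 𝟙 (¬? (inTail? π i)) *_) (𝟙-no (lookup w i Fin.≟ Fin.zero) ¬b))
      (ℤ.*-zeroʳ (- 𝟙 (¬? (inTail? π i)))))
  by-cases : Dec (∀ i → Admissible i) → (Faithful π w × IsNormal π w) ⊎ weight π w ≡ 0ℤ
  by-cases (yes adm) = inj₁ (proj₁ ∘ adm , proj₂ ∘ adm)
  by-cases (no ¬adm) =
    let i , ¬admᵢ = ¬∀⟶∃¬ _ _ admissible? ¬adm
    in inj₂ (∏-zero i _ (vanishes i ¬admᵢ (blank? w i) (inTail? π i)))

-- Only the letter of `π` and the blank can have a nonzero coefficient, so two terms remain.
∑-coefficient : (π : Perm n) (i : Fin n) (b : Fin (suc n) → ℤ) →
  ∑ (allFin (suc n)) (λ x → coefficient π i x * b x) ≡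
  b (Fin.suc (π at i)) + - 𝟙 (¬? (inTail? π i)) * b Fin.zero
∑-coefficient {n} π i b = begin
  ∑ letters (λ x → (δ l x + c * δ Fin.zero x) * b x)
    ≡⟨ ∑-cong letters (λ {x} _ → distribute (δ l x) c (δ Fin.zero x) (b x)) ⟩
  ∑ letters (λ x → δ l x * b x + c * (δ Fin.zero x * b x))
    ≡⟨ ∑-+ (λ x → δ l x * b x) (λ x → c * (δ Fin.zero x * b x)) letters ⟩
  ∑ letters (λ x → δ l x * b x) + ∑ letters (λ x → c * (δ Fin.zero x * b x))
    ≡⟨ cong₂ _+_ (∑-δ l) (trans (∑-*ˡ c (λ x → δ Fin.zero x * b x) letters) (cong (c *_) (∑-δ Fin.zero))) ⟩
  b l + c * b Fin.zero ∎
  where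
  open ≡-Reasoning
  letters : List (Fin (suc n))
  letters = allFin (suc n)
  l : Fin (suc n)
  l = Fin.suc (π at i)
  c : ℤ
  c = - 𝟙 (¬? (inTail? π i))
  δ : Fin (suc n) → Fin (suc n) → ℤ
  δ y x = 𝟙 (x Fin.≟ y)
  ∑-δ : ∀ y → ∑ letters (λ x → δ y x * b x) ≡ b y
  ∑-δ y = ∑-delta Fin._≟_ b (Unique.allFin⁺ (suc n)) (∈-allFin y)
  distribute : ∀ p c q b → (p + c * q) * b ≡ p * b + c * (q * b)
  distribute = solve-∀

-- `EZ` as a weighted sum over words.

∈-Z⁺ : (η : Word₀ n) {i : Fin n} → Blank η i → i Subset.∈ Z η
∈-Z⁺ η {i} b = Vec.lookup⇒[]= i (Z η) (trans (Vec.lookup∘tabulate _ i) (dec-true (blank? η i) b))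

∈-Z⁻ : (η : Word₀ n) {i : Fin n} → i Subset.∈ Z η → Blank η i
∈-Z⁻ η {i} i∈ = decidable-stable (blank? η i) λ ¬b →
  true≢false (trans (sym (Vec.[]=⇒lookup i∈)) (trans (Vec.lookup∘tabulate _ i) (dec-false (blank? η i) ¬b)))
  where
  true≢false : true ≢ false
  true≢false ()

∈-⋂-Z⁺ : (S : List (Word₀ n)) {i : Fin n} → All (λ η → Blank η i) S → i Subset.∈ Subset.⋂ (map Z S)
∈-⋂-Z⁺ []      []       = Subset.∈⊤
∈-⋂-Z⁺ (η ∷ S) (b ∷ bs) = Subset.x∈p∩q⁺ (∈-Z⁺ η b , ∈-⋂-Z⁺ S bs)

∈-⋂-Z⁻ : (S : List (Word₀ n)) {i : Fin n} → i Subset.∈ Subset.⋂ (map Z S) → All (λ η → Blank η i) S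
∈-⋂-Z⁻ []      _  = []
∈-⋂-Z⁻ (η ∷ S) i∈ =
  let i∈Zη , i∈S = Subset.x∈p∩q⁻ (Z η) (Subset.⋂ (map Z S)) i∈ in ∈-Z⁻ η i∈Zη ∷ ∈-⋂-Z⁻ S i∈S

AllBlank : List (Word₀ n) → Fin n → Set
AllBlank S i = All (λ η → Blank η i) S

allBlank? : (S : List (Word₀ n)) → Decidable (AllBlank S)
allBlank? S i = All.all? (λ η → blank? η i) S

InEZ⇒ : (π : Perm n) {S : List (Word₀ n)} → InEZ S → ∀ i → ¬ (¬ InTail π i × AllBlank S i)
InEZ⇒ π {S} (_ , ⋂≡⊥) i (_ , blanks) = Subset.∉⊥ (subst (i Subset.∈_) ⋂≡⊥ (∈-⋂-Z⁺ S blanks))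

-- A common blank in a tail forces one further left in the same adjacency.
InEZ⇐ : (π : Perm (suc n)) {S : List (Word₀ (suc n))} → All (IsRightmost π) S →
        (∀ i → ¬ (¬ InTail π i × AllBlank S i)) → InEZ S
InEZ⇐ π {S} rightmost covered =
    -- For empty `S`, position `0` is the counterexample: it lies in no tail, having nothing to its
    -- left, and is vacuously blank throughout `S`.
    (λ { refl → covered Fin.zero ((λ { (_ , _ , _ , () , _) }) , []) })
  , Subset.Empty-unique (λ (i , i∈) → ¬blanks i (<-wellFounded (toℕ i)) (∈-⋂-Z⁻ S i∈))
  where
  ¬blanks : ∀ i → Acc ℕ._<_ (toℕ i) → ¬ AllBlank S i
  ¬blanks i (acc rec) blanks = covered i (∉tail , blanks)
    where
    ∉tail : ¬ InTail π i
    ∉tail (a , b , adj , a<i , i≤b) = ¬blanks a (rec a<i) (All.zipWith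
      (λ { {η} (right , blank) → decidable-stable (blank? η a) λ ¬blank →
           right a b adj a i ℕ.≤-refl a<i i≤b ¬blank blank })
      (rightmost , blanks))

-- By the two implications above, `InEZ S` means that no position outside the tails is blank in all
-- of `S`. This factors over positions, and each factor, one minus a product of two indicators, is a
-- sum over the letters possible there. Multiplying out is Möbius inversion on the product of
-- chains.
𝟙-inEZ : (π : Perm (suc n)) {S : List (Word₀ (suc n))} → All (IsRightmost π) S →
  𝟙 (inEZ? S) ≡ ∑[ w ← words (suc n) ] (weight π w * 𝟙 (All.all? (_⊑? w) S))
𝟙-inEZ {n} π {S} rightmost = begin
  𝟙 (inEZ? S)
    ≡⟨ 𝟙-cong (inEZ? S) (all? uncovered?) (InEZ⇒ π) (InEZ⇐ π rightmost) ⟩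
  𝟙 (all? uncovered?)
    ≡⟨ ∏-𝟙 uncovered? (all? uncovered?) ⟨
  ∏ (λ i → 𝟙 (uncovered? i))
    ≡⟨ ∏-cong factor ⟩
  ∏ (λ i → ∑ (allFin (suc (suc n))) (λ x → coefficient π i x * b i x))
    ≡⟨ ∑-vectors (allFin (suc (suc n))) (λ i x → coefficient π i x * b i x) ⟨
  ∑ (words (suc n)) (λ w → ∏ (λ i → coefficient π i (lookup w i) * b i (lookup w i)))
    ≡⟨ ∑-cong (words (suc n)) (λ {w} _ → trans (∏-* (λ i → coefficient π i (lookup w i)) (λ i → b i (lookup w i)))
         (cong (weight π w *_) (below w))) ⟩
  ∑ (words (suc n)) (λ w → weight π w * 𝟙 (All.all? (_⊑? w) S)) ∎
  where
  open ≡-Reasoning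
  uncovered? : Decidable (λ i → ¬ (¬ InTail π i × AllBlank S i))
  uncovered? i = ¬? (¬? (inTail? π i) ×-dec allBlank? S i)
  implied? : ∀ i x → Dec (x ≡ Fin.zero → AllBlank S i)
  implied? i x = (x Fin.≟ Fin.zero) →-dec allBlank? S i
  b : Fin (suc n) → Fin (suc (suc n)) → ℤ
  b i x = 𝟙 (implied? i x)
  𝟙-¬× : ∀ {A B : Set} (a? : Dec A) (b? : Dec B) → 𝟙 (¬? (a? ×-dec b?)) ≡ 1ℤ + - 𝟙 a? * 𝟙 b?
  𝟙-¬× (yes a) (yes b) = refl
  𝟙-¬× (yes a) (no ¬b) = refl
  𝟙-¬× (no ¬a) b?      = refl
  factor : ∀ i → 𝟙 (uncovered? i) ≡ ∑ (allFin (suc (suc n))) (λ x → coefficient π i x * b i x)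
  factor i = begin
    𝟙 (uncovered? i)
      ≡⟨ 𝟙-¬× (¬? (inTail? π i)) (allBlank? S i) ⟩
    1ℤ + - 𝟙 (¬? (inTail? π i)) * 𝟙 (allBlank? S i)
      ≡⟨ cong₂ (λ x y → x + - 𝟙 (¬? (inTail? π i)) * y)
           (sym (𝟙-yes (implied? i (Fin.suc (π at i))) (λ ())))
           (𝟙-cong (allBlank? S i) (implied? i Fin.zero) (λ blanks _ → blanks) (λ f → f refl)) ⟩
    b i (Fin.suc (π at i)) + - 𝟙 (¬? (inTail? π i)) * b i Fin.zero
      ≡⟨ ∑-coefficient π i (b i) ⟨
    ∑ (allFin (suc (suc n))) (λ x → coefficient π i x * b i x) ∎
  below : ∀ w → ∏ (λ i → b i (lookup w i)) ≡ 𝟙 (All.all? (_⊑? w) S)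
  -- Exchanges the quantifiers over positions and over members of `S`.
  below w = ∏-𝟙 (λ i → implied? i (lookup w i)) (map′
    (λ all i blank → All.map (λ η⊑w → η⊑w i blank) all)
    (λ imp → All.tabulate (λ η∈ i blank → All.lookup (imp i blank) η∈))
    (All.all? (_⊑? w) S))

sublists⊆ : (xs : List A) {S : List A} → All P xs → S ∈ sublists xs → All P S
sublists⊆ []       []         (here refl) = []
sublists⊆ {P = P} (x ∷ xs) (px ∷ pxs) S∈ with ∈-++⁻ (map (x ∷_) (sublists xs)) S∈
... | inj₁ S∈₁ = let T , T∈ , S≡ = ∈-map⁻ (x ∷_) S∈₁ in subst (All P) (sym S≡) (px ∷ sublists⊆ xs pxs T∈)
... | inj₂ S∈₂ = sublists⊆ xs pxs S∈₂

-- The case `S = []` of `𝟙-inEZ`: the empty list is excluded by `InEZ`, yet all its members lie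
-- below every word.
∑-weight : (π : Perm (suc n)) → ∑ (words (suc n)) (weight π) ≡ 0ℤ
∑-weight {n} π = trans (∑-cong (words (suc n)) (λ {w} _ → sym (ℤ.*-identityʳ (weight π w)))) (sym (𝟙-inEZ π []))

-- After the sums over `S` and `w` are exchanged, the inner alternating sum is `1` minus the
-- indicator that some member of `Ê` lies below `w`. The `1` contributes the total weight, which is
-- zero.
EZ-∑ : ∀ ρ ((n , π) : 𝒫) →
  EZ ρ (n , π) ≡ ∑[ w ← words (suc n) ] (- (weight π w * 𝟙 (Any.any? (_⊑? w) (Ê (proj₂ ρ) π))))
EZ-∑ ρ (n , π) = begin
  ∑ (filter inEZ? (sublists X)) sign
    ≡⟨ ∑-filter inEZ? sign (sublists X) ⟩
  ∑ (sublists X) (λ S → 𝟙 (inEZ? S) * sign S)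
    ≡⟨ ∑-cong (sublists X) (λ {S} S∈ → trans
         (cong (_* sign S) (𝟙-inEZ π (sublists⊆ X rightmost S∈)))
         (trans (sym (∑-*ʳ (sign S) (λ w → weight π w * 𝟙 (All.all? (_⊑? w) S)) W))
           (∑-cong W (λ {w} _ → rotate (weight π w) (𝟙 (All.all? (_⊑? w) S)) (sign S))))) ⟩
  (∑[ S ← sublists X ] (∑[ w ← W ] (weight π w * (sign S * 𝟙 (All.all? (_⊑? w) S)))))
    ≡⟨ ∑-swap (λ S w → weight π w * (sign S * 𝟙 (All.all? (_⊑? w) S))) (sublists X) W ⟩
  (∑[ w ← W ] (∑[ S ← sublists X ] (weight π w * (sign S * 𝟙 (All.all? (_⊑? w) S)))))
    ≡⟨ ∑-cong W (λ {w} _ → trans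
         (∑-*ˡ (weight π w) (λ S → sign S * 𝟙 (All.all? (_⊑? w) S)) (sublists X))
         (trans (cong (weight π w *_) (∑-sublists-all (_⊑? w) X)) (distribute (weight π w) (meets w)))) ⟩
  (∑[ w ← W ] (weight π w + - (weight π w * meets w)))
    ≡⟨ ∑-+ (weight π) (λ w → - (weight π w * meets w)) W ⟩
  ∑ W (weight π) + (∑[ w ← W ] (- (weight π w * meets w)))
    ≡⟨ cong (_+ (∑[ w ← W ] (- (weight π w * meets w)))) (∑-weight π) ⟩
  0ℤ + (∑[ w ← W ] (- (weight π w * meets w)))
    ≡⟨ ℤ.+-identityˡ _ ⟩
  (∑[ w ← W ] (- (weight π w * meets w))) ∎
  where
  open ≡-Reasoning
  X W : List (Word₀ (suc n))
  X = Ê (proj₂ ρ) π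
  W = words (suc n)
  sign : List (Word₀ (suc n)) → ℤ
  sign S = -1ℤ ^ length S
  meets : Word₀ (suc n) → ℤ
  meets w = 𝟙 (Any.any? (_⊑? w) X)
  rightmost : All (IsRightmost π) X
  rightmost = All.all-filter (isRightmost? π) (embeddings (proj₂ ρ) π)
  rotate : ∀ a b c → a * b * c ≡ a * (c * b)
  rotate = solve-∀
  distribute : ∀ a b → a * (1ℤ + - b) ≡ a + - (a * b)
  distribute = solve-∀

-- Sliding occurrences to the right within adjacencies.

Avoids : Word₀ n → Vec (Fin n) k → Set
Avoids w f = ∀ i → ¬ Blank w (lookup f i)

Consecutive : ℕ → ℕ → Set
Consecutive v v′ = v′ ≡ suc v ⊎ v ≡ suc v′

-- No integer lies strictly between consecutive values, so `u`, distinct from both, is on the same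
-- side of both.
consecutive-<ˡ : ∀ {u v v′} → Consecutive v v′ → u ≢ v → u ≢ v′ → v ℕ.< u → v′ ℕ.< u
consecutive-<ˡ (inj₁ refl) u≢v u≢v′ v<u = ℕ.≤∧≢⇒< v<u (u≢v′ ∘ sym)
consecutive-<ˡ (inj₂ refl) u≢v u≢v′ v<u = ℕ.<-trans (ℕ.n<1+n _) v<u

consecutive-<ʳ : ∀ {u v v′} → Consecutive v v′ → u ≢ v → u ≢ v′ → u ℕ.< v → u ℕ.< v′
consecutive-<ʳ (inj₁ refl) u≢v u≢v′ u<v = ℕ.<-trans u<v (ℕ.n<1+n _)
consecutive-<ʳ (inj₂ refl) u≢v u≢v′ u<v = ℕ.≤∧≢⇒< (ℕ.s≤s⁻¹ u<v) u≢v′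

consecutive-sym : ∀ {v v′} → Consecutive v v′ → Consecutive v′ v
consecutive-sym (inj₁ e) = inj₂ e
consecutive-sym (inj₂ e) = inj₁ e

-- The new position is next to the old one and the new value next to the old value. Another chosen
-- letter can separate neither pair, so all comparisons survive.
slide-occurrence : (σ : Perm k) (π : Perm n) (f : Vec (Fin n) k) (i : Fin k) {q : Fin n} →
  IsOccurrence σ π f → toℕ q ≡ suc (toℕ (lookup f i)) →
  Consecutive (toℕ (π at lookup f i)) (toℕ (π at q)) → ¬ (q ∈ᵛ f) →
  IsOccurrence σ π (f [ i ]≔ q)
slide-occurrence {k} {n} σ π f i {q} (inc , iso) q≡1+p consec q∉f = inc′ , iso′
  where
  p : Fin n
  p = lookup f i
  f′ : Fin k → Fin n
  f′ = lookup (f [ i ]≔ q)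
  f′-i : f′ i ≡ q
  f′-i = Vec.lookup∘update i f q
  f′-j : ∀ {j} → j ≢ i → f′ j ≡ lookup f j
  f′-j j≢i = Vec.lookup∘update′ j≢i f q
  q≢ : ∀ j → q ≢ lookup f j
  q≢ j e = q∉f (subst (_∈ᵛ f) (sym e) (∈-lookup j f))
  inc′ : ∀ j l → j Fin.< l → f′ j Fin.< f′ l
  inc′ j l j<l with j Fin.≟ i | l Fin.≟ i
  ... | yes refl | yes refl = contradiction j<l (ℕ.<-irrefl refl)
  ... | yes refl | no l≢i   = subst₂ Fin._<_ (sym f′-i) (sym (f′-j l≢i))
    (ℕ.≤∧≢⇒< (subst (ℕ._≤ _) (sym q≡1+p) (inc j l j<l)) (q≢ l ∘ Fin.toℕ-injective))
  ... | no j≢i   | yes refl = subst₂ Fin._<_ (sym (f′-j j≢i)) (sym f′-i)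
    (ℕ.<-trans (inc j l j<l) (ℕ.≤-reflexive (sym q≡1+p)))
  ... | no j≢i   | no l≢i   = subst₂ Fin._<_ (sym (f′-j j≢i)) (sym (f′-j l≢i)) (inc j l j<l)
  π-≢ : ∀ {x y} → x ≢ y → toℕ (π at x) ≢ toℕ (π at y)
  π-≢ x≢y e = x≢y (at-injective π (Fin.toℕ-injective e))
  ≢p : ∀ {j} → j ≢ i → toℕ (π at lookup f j) ≢ toℕ (π at p)
  ≢p j≢i = π-≢ (j≢i ∘ increasing-injective (lookup f) inc)
  ≢q : ∀ j → toℕ (π at lookup f j) ≢ toℕ (π at q)
  ≢q j = π-≢ (q≢ j ∘ sym)
  iso′ : ∀ j l → (σ at j Fin.< σ at l) ⇔ (π at f′ j Fin.< π at f′ l)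
  iso′ j l with j Fin.≟ i | l Fin.≟ i
  ... | yes refl | yes refl = mk⇔ (λ lt → contradiction lt (ℕ.<-irrefl refl))
                                  (λ lt → contradiction lt (ℕ.<-irrefl refl))
  ... | yes refl | no l≢i   = subst₂ (λ x y → (σ at j Fin.< σ at l) ⇔ (π at x Fin.< π at y))
    (sym f′-i) (sym (f′-j l≢i))
    (mk⇔ (consecutive-<ˡ consec (≢p l≢i) (≢q l) ∘ to (iso j l))
         (from (iso j l) ∘ consecutive-<ˡ (consecutive-sym consec) (≢q l) (≢p l≢i)))
  ... | no j≢i   | yes refl = subst₂ (λ x y → (σ at j Fin.< σ at l) ⇔ (π at x Fin.< π at y))
    (sym (f′-j j≢i)) (sym f′-i)
    (mk⇔ (consecutive-<ʳ consec (≢p j≢i) (≢q j) ∘ to (iso j l))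
         (from (iso j l) ∘ consecutive-<ʳ (consecutive-sym consec) (≢q j) (≢p j≢i)))
  ... | no j≢i   | no l≢i   = subst₂ (λ x y → (σ at j Fin.< σ at l) ⇔ (π at x Fin.< π at y))
    (sym (f′-j j≢i)) (sym (f′-j l≢i)) (iso j l)

-- Termination measure for sliding: every move to the right lowers it.
slack : Vec (Fin n) k → ℕ
slack         []      = 0
slack {n = n} (x ∷ f) = (n ℕ.∸ toℕ x) ℕ.+ slack f

slack-< : (f : Vec (Fin n) k) (i : Fin k) {q : Fin n} → lookup f i Fin.< q → slack (f [ i ]≔ q) ℕ.< slack f
slack-< (x ∷ f) Fin.zero    {q} x<q = ℕ.+-monoˡ-< (slack f) (ℕ.∸-monoʳ-< x<q (ℕ.<⇒≤ (Fin.toℕ<n q)))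
slack-< {n = n} (x ∷ f) (Fin.suc i) <q = ℕ.+-monoʳ-< (n ℕ.∸ toℕ x) (slack-< f i <q)

RightmostPositions : Perm n → Vec (Fin n) k → Set
RightmostPositions π f = ∀ a b → IsAdjacency π a b →
  ∀ p q → a Fin.≤ p → p Fin.< q → q Fin.≤ b → p ∈ᵛ f → q ∈ᵛ f

module _ {n : ℕ} where
  open DecMembership (Fin._≟_ {n}) using (_∈?_)

  CanSlide : Perm n → (f : Vec (Fin n) k) → Fin k → Fin n → Set
  CanSlide π f i q = ¬ (q ∈ᵛ f) × toℕ q ≡ suc (toℕ (lookup f i)) ×
    ∃ λ a → ∃ λ b → IsAdjacency π a b × a Fin.≤ lookup f i × q Fin.≤ b

  canSlide? : (π : Perm n) (f : Vec (Fin n) k) (i : Fin k) → Decidable (CanSlide π f i)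
  canSlide? π f i q = ¬? (q ∈? f) ×-dec (toℕ q ℕ.≟ suc (toℕ (lookup f i))) ×-dec
    any? λ a → any? λ b → isAdjacency? π a b ×-dec (a Fin.≤? lookup f i) ×-dec (q Fin.≤? b)

  -- A chosen position followed by an unchosen one in the same adjacency would allow a slide. Hence
  -- being chosen propagates from `p` to the right, one position at a time.
  stuck⇒rightmost : (π : Perm n) (f : Vec (Fin n) k) → (∀ i q → ¬ CanSlide π f i q) → RightmostPositions π f
  stuck⇒rightmost π f stuck a b adj p q a≤p p<q q≤b p∈f =
    -- The counter is the distance from `p + 1` to `q`, so the base case is itself one step from
    -- `p`.
    walk (toℕ q ℕ.∸ suc (toℕ p)) q (sym (ℕ.m∸n+n≡m p<q)) q≤b
    where
    step : ∀ r q → toℕ q ≡ suc (toℕ r) → a Fin.≤ r → q Fin.≤ b → r ∈ᵛ f → q ∈ᵛ f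
    step r q q≡1+r a≤r q≤b r∈f = decidable-stable (q ∈? f) λ q∉f →
      stuck (AnyVec.index r∈f) q (q∉f , trans q≡1+r (cong (suc ∘ toℕ) r≡) , a , b , adj ,
        subst (a Fin.≤_) r≡ a≤r , q≤b)
      where r≡ = AnyVec.lookup-index r∈f
    walk : ∀ d q → toℕ q ≡ d ℕ.+ suc (toℕ p) → q Fin.≤ b → q ∈ᵛ f
    walk zero    q           e q≤b = step p q e a≤p q≤b p∈f
    walk (suc d) (Fin.suc r) e q≤b = step (Fin.inject₁ r) (Fin.suc r) (cong suc (sym (Fin.toℕ-inject₁ r)))
      (ℕ.≤-trans a≤p (subst (toℕ p ℕ.≤_) (sym r≡) (ℕ.≤-trans (ℕ.n≤1+n _) (ℕ.m≤n+m _ d))))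
      q≤b
      (walk d (Fin.inject₁ r) r≡ r≤b)
      where
      r≡ : toℕ (Fin.inject₁ r) ≡ d ℕ.+ suc (toℕ p)
      r≡ = trans (Fin.toℕ-inject₁ r) (ℕ.suc-injective e)
      r≤b : Fin.inject₁ r Fin.≤ b
      r≤b = subst (ℕ._≤ toℕ b) (sym (Fin.toℕ-inject₁ r)) (ℕ.<⇒≤ q≤b)

  slide-consecutive : (π : Perm n) {a b : Fin n} → IsAdjacency π a b → ∀ p q → a Fin.≤ p → q Fin.≤ b →
                      toℕ q ≡ suc (toℕ p) → Consecutive (toℕ (π at p)) (toℕ (π at q))
  slide-consecutive π ((_ , inj₁ up)   , _) p q a≤p q≤b e = inj₁ (up p q a≤p q≤b e)
  slide-consecutive π ((_ , inj₂ down) , _) p q a≤p q≤b e = inj₂ (down p q a≤p q≤b e)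

  -- A slide ends on a letter of a tail, which a normal word never blanks.
  slideRight : (σ : Perm k) (π : Perm n) (w : Word₀ n) → IsNormal π w →
    (f : Vec (Fin n) k) → Acc ℕ._<_ (slack f) → IsOccurrence σ π f → Avoids w f →
    ∃ λ g → IsOccurrence σ π g × Avoids w g × RightmostPositions π g
  slideRight σ π w normal f (acc rec) occ avoids with any? (λ i → any? (canSlide? π f i))
  ... | no stuck = f , occ , avoids , stuck⇒rightmost π f (λ i q can → stuck (i , q , can))
  ... | yes (i , q , q∉f , q≡1+p , a , b , adj , a≤p , q≤b) =
    slideRight σ π w normal (f [ i ]≔ q) (rec (slack-< f i p<q))
      (slide-occurrence σ π f i occ q≡1+p (slide-consecutive π adj _ q a≤p q≤b q≡1+p) q∉f) avoids′
    where
    p<q : lookup f i Fin.< q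
    p<q = ℕ.≤-reflexive (sym q≡1+p)
    avoids′ : Avoids w (f [ i ]≔ q)
    avoids′ j with j Fin.≟ i
    ... | yes refl = subst (λ x → ¬ Blank w x) (sym (Vec.lookup∘update i f q))
                       (normal q (a , b , adj , ℕ.≤-<-trans a≤p p<q , q≤b))
    ... | no j≢i   = subst (λ x → ¬ Blank w x) (sym (Vec.lookup∘update′ j≢i f q)) (avoids j)

  -- Passing between occurrences and embeddings.

  wordOf : Perm n → Vec (Fin n) k → Word₀ n
  wordOf π f = tabulate (λ p → if does (p ∈? f) then Fin.suc (π at p) else Fin.zero)

  wordOf-∈ : (π : Perm n) (f : Vec (Fin n) k) → ∀ p → p ∈ᵛ f → lookup (wordOf π f) p ≡ Fin.suc (π at p)
  wordOf-∈ π f p p∈f = trans (Vec.lookup∘tabulate _ p)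
    (cong (λ b → if b then Fin.suc (π at p) else Fin.zero) (dec-true (p ∈? f) p∈f))

  wordOf-∉ : (π : Perm n) (f : Vec (Fin n) k) → ∀ p → ¬ (p ∈ᵛ f) → Blank (wordOf π f) p
  wordOf-∉ π f p p∉f = trans (Vec.lookup∘tabulate _ p)
    (cong (λ b → if b then Fin.suc (π at p) else Fin.zero) (dec-false (p ∈? f) p∉f))

  wordOf-rightmost : (π : Perm n) (f : Vec (Fin n) k) → RightmostPositions π f → IsRightmost π (wordOf π f)
  wordOf-rightmost π f right a b adj p q a≤p p<q q≤b ¬blank blank =
    contradiction (trans (sym (wordOf-∈ π f q q∈f)) blank) λ ()
    where
    q∈f : q ∈ᵛ f
    q∈f = right a b adj p q a≤p p<q q≤b (decidable-stable (p ∈? f) (¬blank ∘ wordOf-∉ π f p))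

  embedding-nonblank : (π : Perm n) (η : Word₀ n) (f : Vec (Fin n) k) →
    (∀ p → p ∈ᵛ f → lookup η p ≡ Fin.suc (π at p)) → ∀ i → ¬ Blank η (lookup f i)
  embedding-nonblank π η f letters i blank = contradiction (trans (sym (letters _ (∈-lookup i f))) blank) λ ()

  embedding-member : (π : Perm n) (η : Word₀ n) (f : Vec (Fin n) k) →
    (∀ p → ¬ (p ∈ᵛ f) → Blank η p) → ∀ p → ¬ Blank η p → ∃ λ i → lookup f i ≡ p
  embedding-member π η f blanks p ¬blank =
    let p∈f = decidable-stable (p ∈? f) (¬blank ∘ blanks p)
    in AnyVec.index p∈f , sym (AnyVec.lookup-index p∈f)

  below⇒occurrence : (σ : Perm k) (π : Perm n) (w : Word₀ n) →
    Any (_⊑ w) (Ê σ π) → ∃ λ f → IsOccurrence σ π f × Avoids w f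
  below⇒occurrence σ π w any =
    let η , η∈ , η⊑w = find any
        η∈E , _ = ∈-filter⁻ (isRightmost? π) {xs = embeddings σ π} η∈
        _ , f , occ , letters , _ = ∈-filter⁻ (isEmbedding? σ π) {xs = words n} η∈E
    in f , occ , λ i blank → embedding-nonblank π η f letters i (η⊑w _ blank)

  -- Sliding right keeps clear of the blanks of a normal `w` and ends in a rightmost embedding. For
  -- such `w`, the restriction to rightmost embeddings therefore loses no pattern.
  occurrence⇒below : (σ : Perm k) (π : Perm n) (w : Word₀ n) → IsNormal π w →
    (∃ λ f → IsOccurrence σ π f × Avoids w f) → Any (_⊑ w) (Ê σ π)
  occurrence⇒below σ π w normal (f , occ , avoids) =
    let g , occ′ , avoids′ , right = slideRight σ π w normal f (<-wellFounded (slack f)) occ avoids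
    in lose (∈-filter⁺ (isRightmost? π)
          (∈-filter⁺ (isEmbedding? σ π) (∈-words (wordOf π g)) (g , occ′ , wordOf-∈ π g , wordOf-∉ π g))
          (wordOf-rightmost π g right))
        (λ i blank → wordOf-∉ π g i λ i∈g →
          avoids′ (AnyVec.index i∈g) (subst (Blank w) (AnyVec.lookup-index i∈g) blank))

-- Signs and the weights of normal embeddings.

∏-const : ∀ c n → ∏ {n} (λ _ → c) ≡ c ^ n
∏-const c zero    = refl
∏-const c (suc n) = cong (c *_) (∏-const c n)

sign : Dec A → ℤ
sign a? = if does a? then 1ℤ else -1ℤ

sign-yes : (a? : Dec A) → A → sign a? ≡ 1ℤ
sign-yes a? a = cong (λ b → if b then 1ℤ else -1ℤ) (dec-true a? a)

sign-no : (a? : Dec A) → ¬ A → sign a? ≡ -1ℤ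
sign-no a? ¬a = cong (λ b → if b then 1ℤ else -1ℤ) (dec-false a? ¬a)

∏-sign-≢ : (x : Fin n) → ∏ (λ i → sign (¬? (i Fin.≟ x))) ≡ -1ℤ
∏-sign-≢ {suc n} Fin.zero    = cong (-1ℤ *_) (∏-1 {n} _ (λ _ → refl))
∏-sign-≢         (Fin.suc x) = trans (ℤ.*-identityˡ _) (∏-sign-≢ x)

-1^-square : ∀ k → -1ℤ ^ k * -1ℤ ^ k ≡ 1ℤ
-1^-square zero    = refl
-1^-square (suc k) = trans (regroup (-1ℤ ^ k)) (-1^-square k)
  where
  regroup : ∀ a → (- 1ℤ * a) * (- 1ℤ * a) ≡ a * a
  regroup = solve-∀

module _ {n : ℕ} where
  open DecMembership (Fin._≟_ {n}) using (_∈?_)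

  -- Prepending a new position to `f` flips exactly one factor, and the extra `-1` compensates.
  -- Keeping `-1ℤ ^ k` on the left avoids truncated subtraction in the exponent.
  ∏-sign-∈ : (f : Vec (Fin n) k) → UniqueVec.Unique f → -1ℤ ^ k * ∏ (λ i → sign (i ∈? f)) ≡ -1ℤ ^ n
  ∏-sign-∈ []      _ = trans (ℤ.*-identityˡ _) (∏-const -1ℤ n)
  ∏-sign-∈ {suc k} (x ∷ f) (x∉f AllPairsVec.∷ f!) = begin
    -1ℤ ^ suc k * ∏ (λ i → sign (i ∈? (x ∷ f)))
      ≡⟨ cong (-1ℤ ^ suc k *_) (trans (∏-cong (λ i → split i (i ∈? f) (i Fin.≟ x)))
           (∏-* (λ i → sign (i ∈? f)) (λ i → sign (¬? (i Fin.≟ x))))) ⟩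
    -1ℤ ^ suc k * (∏ (λ i → sign (i ∈? f)) * ∏ (λ i → sign (¬? (i Fin.≟ x))))
      ≡⟨ cong (λ z → -1ℤ ^ suc k * (∏ (λ i → sign (i ∈? f)) * z)) (∏-sign-≢ x) ⟩
    -1ℤ ^ suc k * (∏ (λ i → sign (i ∈? f)) * -1ℤ)
      ≡⟨ regroup (-1ℤ ^ k) (∏ (λ i → sign (i ∈? f))) ⟩
    -1ℤ ^ k * ∏ (λ i → sign (i ∈? f))
      ≡⟨ ∏-sign-∈ f f! ⟩
    -1ℤ ^ n ∎
    where
    open ≡-Reasoning
    regroup : ∀ a b → (- 1ℤ * a) * (b * - 1ℤ) ≡ a * b
    regroup = solve-∀
    split : ∀ i (d : Dec (i ∈ᵛ f)) (e : Dec (i ≡ x)) → sign (i ∈? (x ∷ f)) ≡ sign d * sign (¬? e)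
    split i (yes i∈f) (yes refl) = contradiction (sym (AnyVec.lookup-index i∈f)) (λ e →
      AllVec.lookup x∉f i∈f refl)
    split i (yes i∈f) (no i≢x)   = sign-yes (i ∈? (x ∷ f)) (AnyVec.there i∈f)
    split i (no i∉f)  (yes i≡x)  = sign-yes (i ∈? (x ∷ f)) (AnyVec.here i≡x)
    split i (no i∉f)  (no i≢x)   = sign-no (i ∈? (x ∷ f)) (λ { (AnyVec.here i≡x) → i≢x i≡x
                                                             ; (AnyVec.there i∈f) → i∉f i∈f })

  -- In a normal word every blank lies outside the tails and contributes `-1`, while each letter
  -- contributes `1`; there are `n - k` blanks.
  weight-embedding : (σ : Perm k) (π : Perm n) (w : Word₀ n) → IsEmbedding σ π w → IsNormal π w →
                     weight π w ≡ -1ℤ ^ ∣ n - k ∣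
  weight-embedding {k} σ π w (f , (inc , _) , letters , blanks) normal = begin
    weight π w
      ≡⟨ ∏-cong (λ i → coefficient-sign i (i ∈? f)) ⟩
    W
      ≡⟨ ℤ.*-identityˡ W ⟨
    1ℤ * W
      ≡⟨ cong (_* W) (-1^-square k) ⟨
    -- The square of `-1ℤ ^ k` is inserted so that `∏-sign-∈` can absorb one copy.
    -1ℤ ^ k * -1ℤ ^ k * W
      ≡⟨ ℤ.*-assoc (-1ℤ ^ k) (-1ℤ ^ k) W ⟩
    -1ℤ ^ k * (-1ℤ ^ k * W)
      ≡⟨ cong (-1ℤ ^ k *_) (∏-sign-∈ f f-unique) ⟩
    -1ℤ ^ k * -1ℤ ^ n
      ≡⟨ cong (λ m → -1ℤ ^ k * -1ℤ ^ m) (ℕ.m+[n∸m]≡n k≤n) ⟨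
    -1ℤ ^ k * -1ℤ ^ (k ℕ.+ (n ℕ.∸ k))
      ≡⟨ cong (-1ℤ ^ k *_) (ℤ.^-distribˡ-+-* -1ℤ k (n ℕ.∸ k)) ⟩
    -1ℤ ^ k * (-1ℤ ^ k * -1ℤ ^ (n ℕ.∸ k))
      ≡⟨ ℤ.*-assoc (-1ℤ ^ k) (-1ℤ ^ k) _ ⟨
    -1ℤ ^ k * -1ℤ ^ k * -1ℤ ^ (n ℕ.∸ k)
      ≡⟨ cong (_* -1ℤ ^ (n ℕ.∸ k)) (-1^-square k) ⟩
    1ℤ * -1ℤ ^ (n ℕ.∸ k)
      ≡⟨ ℤ.*-identityˡ _ ⟩
    -1ℤ ^ (n ℕ.∸ k)
      ≡⟨ cong (-1ℤ ^_) (ℕ.m≤n⇒∣n-m∣≡n∸m k≤n) ⟨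
    -1ℤ ^ ∣ n - k ∣ ∎
    where
    open ≡-Reasoning
    W : ℤ
    W = ∏ (λ i → sign (i ∈? f))
    k≤n : k ℕ.≤ n
    k≤n = Fin.injective⇒≤ (increasing-injective (lookup f) inc)
    f-unique : UniqueVec.Unique f
    f-unique = subst UniqueVec.Unique (Vec.tabulate∘lookup f)
      (UniqueVec.tabulate⁺ (increasing-injective (lookup f) inc))
    coefficient-sign : ∀ i (d : Dec (i ∈ᵛ f)) → coefficient π i (lookup w i) ≡ sign d
    coefficient-sign i (yes i∈f) = trans (cong (coefficient π i) (letters i i∈f)) (coefficient-letter π i)
    coefficient-sign i (no i∉f)  = trans (cong (coefficient π i) (blanks i i∉f)) (trans (coefficient-blank π i)
      (cong -_ (𝟙-yes (¬? (inTail? π i)) (λ ∈tail → normal i ∈tail (blanks i i∉f)))))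

  -- Both occurrences use exactly the nonblank positions of `w`, so one factors through the other.
  -- Applied in both directions, this shows that a word embeds at most one permutation.
  embedding-≼ : (ρ : Perm k) (σ : Perm m) (π : Perm n) (w : Word₀ n) →
                IsEmbedding ρ π w → IsEmbedding σ π w → ∃ (IsOccurrence ρ σ)
  embedding-≼ ρ σ π w (g , g-occ , letters , _) (f , f-occ , _ , blanks) =
    occurrence-factor ρ σ π f g f-occ g-occ
      (λ i → embedding-member π w f blanks _ (embedding-nonblank π w g letters i))

  -- The top of the product of chains.
  full : Perm n → Word₀ n
  full π = tabulate (λ i → Fin.suc (π at i))

  full-letter : (π : Perm n) (i : Fin n) → lookup (full π) i ≡ Fin.suc (π at i)
  full-letter π = Vec.lookup∘tabulate _

  full-nonblank : (π : Perm n) (i : Fin n) → ¬ Blank (full π) i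
  full-nonblank π i blank = contradiction (trans (sym (full-letter π i)) blank) λ ()

  weight-full : (π : Perm n) → weight π (full π) ≡ 1ℤ
  weight-full π = ∏-1 _ (λ i → trans (cong (coefficient π i) (full-letter π i)) (coefficient-letter π i))

  embedding-full : (π : Perm n) → IsEmbedding π π (full π)
  embedding-full π = tabulate id , tabulate-occurrence π π id (λ _ _ i<j → i<j) (λ _ _ → mk⇔ id id)
    , (λ p _ → full-letter π p)
    , (λ p p∉ → contradiction (subst (_∈ᵛ tabulate id) (Vec.lookup∘tabulate id p) (∈-lookup p (tabulate id))) p∉)

injective⇒surjective : (f : Fin n → Fin n) → (∀ {i j} → f i ≡ f j → i ≡ j) → ∀ p → ∃ λ i → f i ≡ p
injective⇒surjective {suc n} f inj p with any? (λ i → f i Fin.≟ p)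
... | yes p∈f = p∈f
... | no p∉f  = contradiction
  (Fin.injective⇒≤ {f = λ i → punchOut (p≢f i)} (inj ∘ Fin.punchOut-injective (p≢f _) (p≢f _)))
  ℕ.1+n≰n
  where
  p≢f : ∀ i → p ≢ f i
  p≢f i e = p∉f (i , sym e)

-- An increasing map of `Fin n` to itself is injective, hence onto, so no position stays blank.
embedding-self⇒full : (π : Perm n) (w : Word₀ n) → IsEmbedding π π w → w ≡ full π
embedding-self⇒full π w (f , (inc , _) , letters , _) =
  trans (sym (Vec.tabulate∘lookup w)) (Vec.tabulate-cong λ p →
    let i , fi≡p = injective⇒surjective (lookup f) (increasing-injective (lookup f) inc) p
    in letters p (subst (_∈ᵛ f) fi≡p (∈-lookup i f)))

-- `NE` and the sum over the interval, word by word.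

_≟ʷ_ : DecidableEquality (Word₀ n)
_≟ʷ_ = Vec.≡-dec Fin._≟_

words-unique : (n : ℕ) → Unique (words n)
words-unique n = vectors-unique (Unique.allFin⁺ (suc n)) n

-- Words that are not normal have weight zero, and a normal embedding of `σ` has the sign on the
-- left as its weight.
NE-∑ : ∀ ((k , σ) (n , π) : 𝒫) →
  -1ℤ ^ ∣ suc n - suc k ∣ * NE (k , σ) (n , π) ≡
  ∑[ w ← words (suc n) ] (weight π w * 𝟙 (isEmbedding? σ π w))
NE-∑ (k , σ) (n , π) = begin
  s * NE (k , σ) (n , π)
    ≡⟨ cong (s *_) count ⟩
  s * ∑ (words (suc n)) (λ w → 𝟙 (isEmbedding? σ π w) * (𝟙 (isNormal? π w) * 1ℤ))
    ≡⟨ ∑-*ˡ s (λ w → 𝟙 (isEmbedding? σ π w) * (𝟙 (isNormal? π w) * 1ℤ)) (words (suc n)) ⟨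
  ∑ (words (suc n)) (λ w → s * (𝟙 (isEmbedding? σ π w) * (𝟙 (isNormal? π w) * 1ℤ)))
    ≡⟨ ∑-cong (words (suc n)) (λ {w} _ → termwise w (isEmbedding? σ π w) (isNormal? π w)) ⟩
  ∑ (words (suc n)) (λ w → weight π w * 𝟙 (isEmbedding? σ π w)) ∎
  where
  open ≡-Reasoning
  s : ℤ
  s = -1ℤ ^ ∣ suc n - suc k ∣
  count : NE (k , σ) (n , π) ≡ ∑ (words (suc n)) (λ w → 𝟙 (isEmbedding? σ π w) * (𝟙 (isNormal? π w) * 1ℤ))
  count = trans (length-∑ (filter (isNormal? π) (embeddings σ π))) (trans
    (∑-filter (isNormal? π) (λ _ → 1ℤ) (embeddings σ π))
    (∑-filter (isEmbedding? σ π) (λ w → 𝟙 (isNormal? π w) * 1ℤ) (words (suc n))))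
  abnormal : ∀ w → ¬ IsNormal π w → weight π w ≡ 0ℤ
  abnormal w ¬normal = fromInj₂ (λ (_ , normal) → contradiction normal ¬normal) (weight-support π w)
  termwise : ∀ w (e : Dec (IsEmbedding σ π w)) (d : Dec (IsNormal π w)) →
             s * (𝟙 e * (𝟙 d * 1ℤ)) ≡ weight π w * 𝟙 e
  termwise w (no _)    _           = trans (ℤ.*-zeroʳ s) (sym (ℤ.*-zeroʳ (weight π w)))
  termwise w (yes _)   (no ¬normal) = trans (ℤ.*-zeroʳ s) (sym (cong (_* 1ℤ) (abnormal w ¬normal)))
  termwise w (yes emb) (yes normal) = cong (_* 1ℤ) (sym (weight-embedding σ π w emb normal))

-- The entirely blank word is a separate case: 𝒫 has no empty permutation.
∑-below : ∀ ((k , σ) (n , π) : 𝒫) → (k , σ) ≺ (n , π) →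
  (w : Word₀ (suc n)) → Faithful π w → IsNormal π w →
  ∑[ ρ ← interval (k , σ) (n , π) ] (𝟙 (Any.any? (_⊑? w) (Ê (proj₂ ρ) π)) * μ (k , σ) ρ) ≡
  𝟙 (isEmbedding? σ π w) + - (𝟙 (w ≟ʷ full π) * μ (k , σ) (n , π))
∑-below (k , σ) (n , π) σ≺π@(_ , σ≢π) w faithful normal =
  by-length (standardise π (λ p → ¬? (blank? w p)))
  where
  σ′ π′ : 𝒫
  σ′ = k , σ
  π′ = n , π
  I : List 𝒫
  I = interval σ′ π′
  below? : (ρ : 𝒫) → Dec (Any (_⊑ w) (Ê (proj₂ ρ) π))
  below? ρ = Any.any? (_⊑? w) (Ê (proj₂ ρ) π)
  Goal : Set
  Goal = ∑[ ρ ← I ] (𝟙 (below? ρ) * μ σ′ ρ) ≡ 𝟙 (isEmbedding? σ π w) + - (𝟙 (w ≟ʷ full π) * μ σ′ π′)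
  by-length : (∃ λ l → ∃ λ (τ : Perm l) → ∃ λ f → IsOccurrence τ π f ×
    (∀ i → ¬ Blank w (lookup f i)) × (∀ p → ¬ Blank w p → ∃ λ i → lookup f i ≡ p)) → Goal
  by-length (zero , _ , _ , _ , _ , nonblank⇒) = trans
    (trans (∑-cong I (λ {ρ} _ → cong (_* μ σ′ ρ) (𝟙-no (below? ρ) (λ below →
        let g , _ , avoids = below⇒occurrence (proj₂ ρ) π w below in all-blank (lookup g Fin.zero) (avoids Fin.zero)))))
      (∑-zero I))
    (sym (cong₂ (λ x y → x + - (y * μ σ′ π′))
      (𝟙-no (isEmbedding? σ π w) (λ (f , _ , letters , _) →
        all-blank _ (embedding-nonblank π w f letters Fin.zero)))
      (𝟙-no (w ≟ʷ full π) (λ { refl → all-blank Fin.zero (full-nonblank π Fin.zero) }))))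
    where
    all-blank : ∀ p → ¬ ¬ Blank w p
    all-blank p ¬blank with nonblank⇒ p ¬blank
    ... | () , _
  -- The letters kept by `w` form the pattern `τ`, and lying above an embedding of `ρ` becomes
  -- `ρ ≼ τ`.
  by-length (suc l , τ , f , occ , f-nonblank , nonblank⇒) = by-fullness (w ≟ʷ full π)
    where
    τ′ : 𝒫
    τ′ = l , τ
    τ-embedding : IsEmbedding τ π w
    τ-embedding = f , occ
      , (λ p p∈f → subst (λ x → lookup w x ≡ Fin.suc (π at x)) (sym (AnyVec.lookup-index p∈f))
                     (faithful _ (f-nonblank (AnyVec.index p∈f))))
      , (λ p p∉f → decidable-stable (blank? w p) (λ ¬blank →
          let i , fi≡p = nonblank⇒ p ¬blank in p∉f (subst (_∈ᵛ f) fi≡p (∈-lookup i f))))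
    below⇔≼ : ∀ ρ → 𝟙 (below? ρ) ≡ 𝟙 (ρ ≼? τ′)
    below⇔≼ ρ = 𝟙-cong (below? ρ) (ρ ≼? τ′)
      (λ below → let g , g-occ , avoids = below⇒occurrence (proj₂ ρ) π w below in
        occurrence-factor (proj₂ ρ) τ π f g occ g-occ (λ i → nonblank⇒ _ (avoids i)))
      (λ (g , g-occ) → occurrence⇒below (proj₂ ρ) π w normal
        ( tabulate (lookup f ∘ lookup g)
        , occurrence-∘ (proj₂ ρ) τ π f g occ g-occ
        , λ i → subst (λ x → ¬ Blank w x) (sym (Vec.lookup∘tabulate (lookup f ∘ lookup g) i)) (f-nonblank (lookup g i))))
    embeds⇒≡ : ∀ ρ → IsEmbedding (proj₂ ρ) π w → ρ ≡ τ′
    embeds⇒≡ ρ ρ-embedding = ≼-antisym ρ τ′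
      (embedding-≼ (proj₂ ρ) τ π w ρ-embedding τ-embedding)
      (embedding-≼ τ (proj₂ ρ) π w τ-embedding ρ-embedding)
    ≡⇒embeds : ∀ ρ → ρ ≡ τ′ → IsEmbedding (proj₂ ρ) π w
    ≡⇒embeds ρ refl = τ-embedding
    by-fullness : (d : Dec (w ≡ full π)) →
      ∑[ ρ ← I ] (𝟙 (below? ρ) * μ σ′ ρ) ≡ 𝟙 (isEmbedding? σ π w) + - (𝟙 d * μ σ′ π′)
    -- The pattern of the top word is `π` itself, so every `ρ` in the interval counts and the
    -- recurrence gives `- μ σ π`.
    by-fullness (yes w≡full) = begin
      (∑[ ρ ← I ] (𝟙 (below? ρ) * μ σ′ ρ))
        ≡⟨ ∑-cong I (λ {ρ} ρ∈ → trans (cong (_* μ σ′ ρ) (trans (below⇔≼ ρ) (𝟙-yes (ρ ≼? τ′)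
             (subst (ρ ≼_) π≡τ (proj₁ (proj₂ (∈-interval⁻ σ′ π′ ρ ρ∈))))))) (ℤ.*-identityˡ (μ σ′ ρ))) ⟩
      ∑ I (μ σ′)
        ≡⟨ ℤ.neg-involutive (∑ I (μ σ′)) ⟨
      - - ∑ I (μ σ′)
        ≡⟨ cong -_ (μ-≺ σ′ π′ σ≺π) ⟨
      - μ σ′ π′
        ≡⟨ cong -_ (ℤ.*-identityˡ (μ σ′ π′)) ⟨
      - (1ℤ * μ σ′ π′)
        ≡⟨ ℤ.+-identityˡ _ ⟨
      0ℤ + - (1ℤ * μ σ′ π′)
        ≡⟨ cong (_+ - (1ℤ * μ σ′ π′)) (𝟙-no (isEmbedding? σ π w) (λ emb →
             σ≢π (trans (embeds⇒≡ σ′ emb) (sym π≡τ)))) ⟨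
      𝟙 (isEmbedding? σ π w) + - (1ℤ * μ σ′ π′) ∎
      where
      open ≡-Reasoning
      π≡τ : π′ ≡ τ′
      π≡τ = embeds⇒≡ π′ (subst (IsEmbedding π π) (sym w≡full) (embedding-full π))
    -- Here `τ ≺ π`, and the sum over `ρ ≼ τ` is the indicator of `σ ≡ τ`, that is, of `w` being an
    -- embedding of `σ`.
    by-fullness (no w≢full) = begin
      (∑[ ρ ← I ] (𝟙 (below? ρ) * μ σ′ ρ))
        ≡⟨ ∑-cong I (λ {ρ} _ → cong (_* μ σ′ ρ) (below⇔≼ ρ)) ⟩
      (∑[ ρ ← I ] (𝟙 (ρ ≼? τ′) * μ σ′ ρ))
        ≡⟨ ∑-interval-below σ′ τ′ π′ ((f , occ) , λ τ≡π →
             w≢full (embedding-self⇒full π w (≡⇒embeds π′ (sym τ≡π)))) ⟩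
      𝟙 (σ′ ≟ τ′)
        ≡⟨ 𝟙-cong (isEmbedding? σ π w) (σ′ ≟ τ′) (embeds⇒≡ σ′) (≡⇒embeds σ′) ⟨
      𝟙 (isEmbedding? σ π w)
        ≡⟨ ℤ.+-identityʳ _ ⟨
      𝟙 (isEmbedding? σ π w) + - (0ℤ * μ σ′ π′) ∎
      where open ≡-Reasoning

-- Exchanging the sums and assembling the formula.

-- The rearrangement stripped of its combinatorics: `h` stands for the weight, `d` for the indicator
-- of lying below, `e` for that of embedding `σ`, `φ` for that of the top word, and `c` for `μ σ π`.
-- The disjunction lets words of weight zero bypass the evaluation of the inner sum.
∑-exchange : (xs : List A) (ys : List B) (f g : A → ℤ) (h e φ : B → ℤ) (d : B → A → ℤ) (c : ℤ) →
  (∀ x → g x ≡ ∑[ y ← ys ] (- (h y * d y x))) →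
  (∀ y → ∑[ x ← xs ] (d y x * f x) ≡ e y + - (φ y * c) ⊎ h y ≡ 0ℤ) →
  ∑[ x ← xs ] (f x * g x) ≡ - (∑[ y ← ys ] (h y * e y)) + (∑[ y ← ys ] (φ y * (h y * c)))
∑-exchange xs ys f g h e φ d c g≗ inner = begin
  (∑[ x ← xs ] (f x * g x))
    ≡⟨ ∑-cong xs (λ {x} _ → trans (cong (f x *_) (g≗ x))
         (trans (sym (∑-*ˡ (f x) (λ y → - (h y * d y x)) ys))
           (∑-cong ys (λ {y} _ → rotate (f x) (h y) (d y x))))) ⟩
  (∑[ x ← xs ] (∑[ y ← ys ] (- h y * (d y x * f x))))
    ≡⟨ ∑-swap (λ x y → - h y * (d y x * f x)) xs ys ⟩
  (∑[ y ← ys ] (∑[ x ← xs ] (- h y * (d y x * f x))))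
    ≡⟨ ∑-cong ys (λ {y} _ → trans (∑-*ˡ (- h y) (λ x → d y x * f x) xs) (termwise y (inner y))) ⟩
  (∑[ y ← ys ] (- (h y * e y) + φ y * (h y * c)))
    ≡⟨ ∑-+ (λ y → - (h y * e y)) (λ y → φ y * (h y * c)) ys ⟩
  ∑ ys (λ y → - (h y * e y)) + ∑ ys (λ y → φ y * (h y * c))
    ≡⟨ cong (_+ ∑ ys (λ y → φ y * (h y * c))) (∑-neg (λ y → h y * e y) ys) ⟩
  - ∑ ys (λ y → h y * e y) + ∑ ys (λ y → φ y * (h y * c)) ∎
  where
  open ≡-Reasoning
  rotate : ∀ a b c → a * - (b * c) ≡ - b * (c * a)
  rotate = solve-∀
  distribute : ∀ a b d c → - a * (b + - (d * c)) ≡ - (a * b) + d * (a * c)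
  distribute = solve-∀
  vanish : ∀ a b d e c → a ≡ 0ℤ → - a * b ≡ - (a * d) + e * (a * c)
  vanish a b d e c refl = sym (trans (ℤ.+-identityˡ _) (ℤ.*-zeroʳ e))
  termwise : ∀ y → ∑ xs (λ x → d y x * f x) ≡ e y + - (φ y * c) ⊎ h y ≡ 0ℤ →
    - h y * ∑ xs (λ x → d y x * f x) ≡ - (h y * e y) + φ y * (h y * c)
  termwise y (inj₁ inner≡) = trans (cong (- h y *_) inner≡) (distribute (h y) (e y) (φ y) c)
  termwise y (inj₂ h≡0)    = vanish (h y) _ (e y) (φ y) c h≡0

-- The first sum of the exchange is the signed `NE`. In the second only the top word survives; its
-- weight is `1`, which leaves `μ σ π`.
∑-μ*EZ : ∀ σ π → σ ≺ π →
  ∑[ τ ← interval σ π ] (μ σ τ * EZ τ π) ≡ - (-1ℤ ^ ∣ len π - len σ ∣ * NE σ π) + μ σ π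
∑-μ*EZ (k , σ) (n , π) σ≺π = trans
  (∑-exchange (interval (k , σ) (n , π)) (words (suc n)) (μ (k , σ)) (λ τ → EZ τ (n , π)) (weight π)
    (λ w → 𝟙 (isEmbedding? σ π w)) (λ w → 𝟙 (w ≟ʷ full π))
    (λ w τ → 𝟙 (Any.any? (_⊑? w) (Ê (proj₂ τ) π))) (μ (k , σ) (n , π))
    (λ τ → EZ-∑ τ (n , π))
    (λ w → Sum.map₁ (λ (faithful , normal) → ∑-below (k , σ) (n , π) σ≺π w faithful normal)
      (weight-support π w)))
  (cong₂ (λ x y → - x + y) (sym (NE-∑ (k , σ) (n , π)))
    (trans (∑-delta _≟ʷ_ (λ w → weight π w * μ (k , σ) (n , π)) (words-unique (suc n)) (∈-words (full π)))
      (trans (cong (_* μ (k , σ) (n , π)) (weight-full π)) (ℤ.*-identityˡ (μ (k , σ) (n , π))))))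

NE-⋠ : ∀ σ π → ¬ (σ ≼ π) → -1ℤ ^ ∣ len π - len σ ∣ * NE σ π ≡ 0ℤ
NE-⋠ (k , σ) (n , π) σ⋠π = trans (NE-∑ (k , σ) (n , π))
  (trans (∑-cong (words (suc n)) (λ {w} _ → trans
    (cong (weight π w *_) (𝟙-no (isEmbedding? σ π w) (λ (f , occ , _) → σ⋠π (f , occ))))
    (ℤ.*-zeroʳ (weight π w)))) (∑-zero (words (suc n))))

-- The top word is the only embedding of `π` in itself, and its weight is `1`.
NE-refl : ∀ π → -1ℤ ^ ∣ len π - len π ∣ * NE π π ≡ 1ℤ
NE-refl (n , π) = begin
  -1ℤ ^ ∣ suc n - suc n ∣ * NE (n , π) (n , π)
    ≡⟨ NE-∑ (n , π) (n , π) ⟩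
  ∑ (words (suc n)) (λ w → weight π w * 𝟙 (isEmbedding? π π w))
    ≡⟨ ∑-cong (words (suc n)) (λ {w} _ → trans (ℤ.*-comm (weight π w) _) (cong (_* weight π w)
         (𝟙-cong (isEmbedding? π π w) (w ≟ʷ full π) (embedding-self⇒full π w) (λ { refl → embedding-full π })))) ⟩
  ∑ (words (suc n)) (λ w → 𝟙 (w ≟ʷ full π) * weight π w)
    ≡⟨ ∑-delta _≟ʷ_ (weight π) (words-unique (suc n)) (∈-words (full π)) ⟩
  weight π (full π)
    ≡⟨ weight-full π ⟩
  1ℤ ∎
  where open ≡-Reasoning

-- The absolute difference in the exponent has the parity of `len π - len σ` also when `σ` is the
-- longer permutation.
theorem19 : (σ π : 𝒫) →
    μ σ π ≡ -1ℤ ^ ∣ len π - len σ ∣ * NE σ π + (∑[ τ ← interval σ π ] (μ σ τ * EZ τ π))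
theorem19 σ π = by-cases (σ ≟ π) (σ ≼? π)
  where
  F : 𝒫 → ℤ
  F τ = μ σ τ * EZ τ π
  s*NE : ℤ
  s*NE = -1ℤ ^ ∣ len π - len σ ∣ * NE σ π
  cancel : ∀ a b → b ≡ a + (- a + b)
  cancel = solve-∀
  by-cases : Dec (σ ≡ π) → Dec (σ ≼ π) → μ σ π ≡ s*NE + ∑ (interval σ π) F
  by-cases (yes refl) _ = trans (μ-refl σ) (sym (cong₂ _+_ (NE-refl σ)
    (∑-interval-⊀ σ σ F (λ (_ , σ≢σ) → σ≢σ refl))))
  -- The sum over the interval already equals `μ σ π` minus the signed `NE`, so the `NE` terms
  -- cancel.
  by-cases (no σ≢π) (yes σ≼π) = trans (cancel s*NE (μ σ π))
    (cong (s*NE +_) (sym (∑-μ*EZ σ π (σ≼π , σ≢π))))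
  by-cases (no _) (no σ⋠π) = trans (μ-⋠ σ π σ⋠π) (sym (cong₂ _+_ (NE-⋠ σ π σ⋠π)
    (∑-interval-⊀ σ π F (σ⋠π ∘ proj₁))))
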